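{- Let $A\in\mathbb{Z}^{d\times n}$. The completion algorithm described in the context, applied to $A$, terminates (whatever choices are made when selecting elements $s\in C$ and when selecting reducing elements $g\in G$ in the normal form procedure), and it returns a finite set $G\subseteq\mathbb{Z}^d$ such that $\{Q^I_{A,b}:b\in G\}$ contains all extended atomic fibers of $A$.
   Context: For $u,v\in\mathbb{R}^n$ write $u\sqsubseteq v$ if $u^{(j)}v^{(j)}\ge 0$ and $|u^{(j)}|\le |v^{(j)}|$ for all components $j=1,\dots,n$. For $S,T,U\subseteq\mathbb{R}^n$ write $S=T\oplus U$ if for every $z\in S$ there are $z_1\in T$ and $z_2\in U$ with $z_1\sqsubseteq z$, $z_2\sqsubseteq z$ and $z=z_1+z_2$. For $A\in\mathbb{Z}^{d\times n}$ and $b\in\mathbb{Z}^d$, the extended fiber of $b$ is $Q^I_{A,b}:=\{z\in\mathbb{Z}^n: Az=b\}$. The extended fiber $Q^I_{A,b}$ is called atomic (an extended atomic fiber of $A$) if it cannot be written as $Q^I_{A,b}=Q^I_{A,b_1}\oplus Q^I_{A,b_2}$ with two other extended fibers $Q^I_{A,b_1}$, $Q^I_{A,b_2}$ (i.e. with $b_1,b_2\in\mathbb{Z}^d$, $b_1\ne b$ and $b_2\neq b$). In particular, empty extended fibers are not atomic, since they decompose vacuously. Normal form procedure $\mathrm{normalForm}(s,G)$, for $s\in\mathbb{Z}^d$ and a finite $G\subseteq\mathbb{Z}^d$: while there is some $g\in G$ such that $Q^I_{A,s}=Q^I_{A,g}\oplus Q^I_{A,s-g}$, replace $s$ by $s-g$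 for such a $g$; when no such $g$ exists, return $s$. Completion algorithm. Let $e_1,\dots,e_n$ be the unit vectors of $\mathbb{R}^n$. Input: $F:=\{Ae_1,\dots,Ae_n,-Ae_1,\dots,-Ae_n\}\setminus\{0\}$. (1) Set $G:=F$ and $C:=\{f+g: f,g\in G\}$ (the case $f=g$ is included). (2) While $C\ne\emptyset$: choose an element $s\in C$; set $C:=C\setminus\{s\}$; compute $f:=\mathrm{normalForm}(s,G)$; if $f\neq 0$, set $G:=G\cup\{f\}$ and then $C:=C\cup\{f+g: g\in G\}$ (with the updated $G$). (3) Set $G:=G\cup\{0\}$ and return $G$. -}

module Defs where

open import Data.Fin using (Fin)
open import Data.Integer using (ℤ; 0ℤ; 1ℤ; _+_; _*_; -_; _-_; _≤_; ∣_∣)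
open import Data.Integer.Properties using () renaming (_≟_ to _≟ℤ_)
open import Data.List using (List; []; _∷_; _++_; allFin; cartesianProductWith; filter; map)
open import Data.List.Membership.Propositional using (_∈_)
import Data.Nat as ℕ
open import Data.Nat using (ℕ)
open import Data.Product using (_×_; ∃-syntax)
open import Data.Vec as Vec using (Vec; lookup; replicate; zipWith; _[_]≔_)
open import Data.Vec.Properties using (≡-dec)
open import Level using (0ℓ)
open import Relation.Binary.Definitions using (DecidableEquality)
open import Relation.Binary.PropositionalEquality using (_≡_; _≢_)
open import Relation.Nullary using (¬_)
open import Relation.Nullary.Decidable using (¬?)
open import Relation.Unary using (Pred)

infix  8 ℤ^_
infix  4 _≟ᵛ_ _⊑_ _＝_⊕_
infixl 6 _+ᵛ_ _-ᵛ_ _∖_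
infixr 7 _*ᵛ_
infix  8 -ᵛ_

ℤ^_ : ℕ → Set
ℤ^ n = Vec ℤ n

Matrix : ℕ → ℕ → Set
Matrix d n = Vec (ℤ^ n) d

0ᵛ : ∀ {n} → ℤ^ n
0ᵛ = replicate _ 0ℤ

_+ᵛ_ _-ᵛ_ : ∀ {n} → ℤ^ n → ℤ^ n → ℤ^ n
_+ᵛ_ = zipWith _+_
_-ᵛ_ = zipWith _-_

-ᵛ_ : ∀ {n} → ℤ^ n → ℤ^ n
-ᵛ_ = Vec.map (λ x → - x)

_≟ᵛ_ : ∀ {n} → DecidableEquality (ℤ^ n)
_≟ᵛ_ = ≡-dec _≟ℤ_

unit : ∀ {n} → Fin n → ℤ^ n
unit i = 0ᵛ [ i ]≔ 1ℤ

dot : ∀ {n} → ℤ^ n → ℤ^ n → ℤ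
dot u v = Vec.foldr _ _+_ 0ℤ (zipWith _*_ u v)

_*ᵛ_ : ∀ {d n} → Matrix d n → ℤ^ n → ℤ^ d
A *ᵛ z = Vec.map (λ row → dot row z) A

_⊑_ : ∀ {n} → ℤ^ n → ℤ^ n → Set
u ⊑ v = ∀ j → (0ℤ ≤ lookup u j * lookup v j) × (∣ lookup u j ∣ ℕ.≤ ∣ lookup v j ∣)

-- Only the inclusion of S in the sum is required, so an empty S decomposes
-- into any T and U.
_＝_⊕_ : ∀ {n} → Pred (ℤ^ n) 0ℓ → Pred (ℤ^ n) 0ℓ → Pred (ℤ^ n) 0ℓ → Set
S ＝ T ⊕ U = ∀ z → S z →
  ∃[ z₁ ] ∃[ z₂ ] (T z₁ × U z₂ × z₁ ⊑ z × z₂ ⊑ z × z ≡ z₁ +ᵛ z₂)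

Fiber : ∀ {d n} → Matrix d n → ℤ^ d → Pred (ℤ^ n) 0ℓ
Fiber A b z = A *ᵛ z ≡ b

Atomic : ∀ {d n} → Matrix d n → ℤ^ d → Set
Atomic A b = ¬ (∃[ b₁ ] ∃[ b₂ ]
  (b₁ ≢ b × b₂ ≢ b × (Fiber A b ＝ Fiber A b₁ ⊕ Fiber A b₂)))

-- A list stands for the finite set of its members; order and multiplicity
-- play no role below.
FinSet : ℕ → Set
FinSet d = List (ℤ^ d)

-- Removes every occurrence.
_∖_ : ∀ {d} → FinSet d → ℤ^ d → FinSet d
C ∖ s = filter (λ t → ¬? (t ≟ᵛ s)) C

ReducibleBy : ∀ {d n} → Matrix d n → ℤ^ d → ℤ^ d → Set
ReducibleBy A s g = Fiber A s ＝ Fiber A g ⊕ Fiber A (s -ᵛ g)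

Irreducible : ∀ {d n} → Matrix d n → FinSet d → ℤ^ d → Set
Irreducible A G s = ¬ (∃[ g ] (g ∈ G × ReducibleBy A s g))

generators : ∀ {d n} → Matrix d n → FinSet d
generators {n = n} A = (columns ++ map (λ a → -ᵛ a) columns) ∖ 0ᵛ
  where columns = map (λ i → A *ᵛ unit i) (allFin n)

-- The algorithm as a transition system: `loop G C` is the head of the while
-- loop, and `normalising s G C` is the normal form procedure, with current
-- vector s, called from the body of that loop.
data Config (d : ℕ) : Set where
  loop        : (G C : FinSet d) → Config d
  normalising : (s : ℤ^ d) (G C : FinSet d) → Config d
  returned    : (G : FinSet d) → Config d

-- Every choice of s and g left open by the algorithm is a separate transition.
data Step {d n} (A : Matrix d n) : Config d → Config d → Set where
  choose  : ∀ {G C s} → s ∈ C →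
            Step A (loop G C) (normalising s G (C ∖ s))
  reduce  : ∀ {G C s g} → g ∈ G → ReducibleBy A s g →
            Step A (normalising s G C) (normalising (s -ᵛ g) G C)
  discard : ∀ {G C f} → Irreducible A G f → f ≡ 0ᵛ →
            Step A (normalising f G C) (loop G C)
  extend  : ∀ {G C f} → Irreducible A G f → f ≢ 0ᵛ →
            Step A (normalising f G C) (loop (f ∷ G) (C ++ map (f +ᵛ_) (f ∷ G)))
  exit    : ∀ {G} → Step A (loop G []) (returned (0ᵛ ∷ G))

start : ∀ {d n} → Matrix d n → Config d
start A = loop F (cartesianProductWith _+ᵛ_ F F)
  where F = generators A

{-# OPTIONS --safe #-}
-- A vector g reduces s iff every point of the fiber of s dominates (⊑) a point of the fiber of g.
-- Every fiber has a finite computable basis of points below all others, so this is decidable.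
-- Describing the complement of the up-closure of a fiber by finitely many boxes, Dickson's lemma
-- with infinite bounds together with the Hoare order on finite sets shows that reducibility is a
-- well-quasi-order; hence only finitely many irreducible vectors can be added.
--
-- On termination every sum f + g of elements of G reduces to 0.  Given b ≠ 0, write all basis points
-- of its fiber simultaneously as sums of points in the fibers of g₁, …, gₘ ∈ G.  If the g₁-parts are
-- not all ⊑ the respective basis points, then some g₁-part cancels against a gᵢ-part, and replacing
-- g₁ + gᵢ by its reduction lowers the total norm of the parts.  Thus finally g₁ reduces b, and b is
-- atomic only if b = g₁.
module Submission where

import Algebra.Construct.Pointwise as Pointwise
import Algebra.Properties.CommutativeMonoid.Mult as Mult
import Algebra.Properties.CommutativeMonoid.Sum as Sum
import Algebra.Solver.CommutativeMonoid as CMSolver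
import Data.Fin.Properties as FinP
import Data.Integer as ℤ
import Data.Integer.Properties as ℤP
import Data.List.Relation.Unary.All.Properties as AllP
import Data.List.Relation.Unary.Any.Properties as AnyP
import Data.Nat.Properties as ℕP
open import Algebra.Bundles using (CommutativeMonoid)
open import Algebra.Morphism.Structures using (module MonoidMorphisms)
open import Algebra.Properties.CommutativeSemigroup ℕP.+-commutativeSemigroup using () renaming (interchange to +ℕ-interchange; x∙yz≈y∙xz to +ℕ-swapˡ; xy∙z≈xz∙y to +ℕ-swapʳ)
open import Data.Empty using (⊥)
open import Data.Fin using (Fin; zero; suc; _↑ˡ_; _↑ʳ_; splitAt)
open import Data.Fin.Properties using (splitAt-↑ˡ; splitAt-↑ʳ)
open import Data.Integer using (ℤ; 0ℤ; 1ℤ; +_; -[1+_]; +≤+; -≤+; ∣_∣; _◃_; _⊖_) renaming (_+_ to _+ℤ_; -_ to -ℤ_; _-_ to _-ℤ_; _*_ to _*ℤ_; _≤_ to _≤ℤ_; _≤?_ to _≤ℤ?_)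
open import Data.Integer.Tactic.RingSolver using (solve-∀)
open import Data.List as List using (List; []; _∷_; _++_; allFin; cartesianProductWith; length; map)
open import Data.List.Membership.Propositional using (_∈_; find; lose)
open import Data.List.Membership.Propositional.Properties using (∈-++⁺ˡ; ∈-++⁺ʳ; ∈-++⁻; ∈-allFin; ∈-cartesianProductWith⁺; ∈-cartesianProductWith⁻; ∈-filter⁺; ∈-filter⁻; ∈-lookup; ∈-map⁺; ∈-map⁻)
open import Data.List.Properties using (filter-notAll)
open import Data.List.Relation.Binary.Subset.Propositional using () renaming (_⊆_ to _⊆ˡ_)
open import Data.List.Relation.Unary.All as All using (All; []; _∷_)
open import Data.List.Relation.Unary.Any as Any using (Any; here; there)
open import Data.Maybe using (Maybe; just; nothing)
open import Data.Nat using (ℕ; zero; suc; z≤n; s≤s; _<_; _∸_; _⊓_) renaming (_≤_ to _≤ℕ_; _+_ to _+ℕ_; _*_ to _*ℕ_)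
open import Data.Nat.Induction using (<-wellFounded)
open import Data.Product using (_×_; ∃-syntax; _,_; proj₁; proj₂)
open import Data.Sign using (Sign)
open import Data.Sum using (_⊎_; inj₁; inj₂; [_,_]; [_,_]′)
open import Data.Unit using (⊤; tt)
open import Data.Vec as Vec using ([]; _∷_; lookup; tabulate)
open import Data.Vec.Properties using (lookup-map; lookup-replicate; lookup-zipWith; lookup∘tabulate; tabulate-cong; tabulate∘lookup; zipWith-assoc; zipWith-comm; zipWith-identityʳ; zipWith-identityˡ)
open import Function using (flip; id; _on_; _∘_)
open import Induction.WellFounded using (Acc; acc)
open import Level using (0ℓ)
open import Relation.Binary.Construct.Closure.ReflexiveTransitive using (Star)
open import Relation.Binary.Core using (Rel)
open import Relation.Binary.PropositionalEquality as ≡ using (_≡_; _≢_; module ≡-Reasoning)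
open import Relation.Nullary using (Dec; ¬_; contradiction; no; yes)
open import Relation.Nullary.Decidable using (map′; ¬?; _×-dec_)
open import Relation.Unary using (Pred; _⊆_; _≐_)
open import Defs
open Sum ℕP.+-0-commutativeMonoid using (sum; sum-cong-≗; ∑-distrib-+)

-- The statement "g reduces s" says that every basis point of s dominates some basis point of g.
-- Over an arbitrary well-quasi-order this comparison of finite sets need not be a well-quasi-order
-- again (Rado's example), so special structure of ℕᵐ has to be used. Passing to complements turns
-- it into inclusion of down-sets, and writing those as finite unions of boxes makes the Hoare order
-- sufficient for inclusion; the Hoare order inherits almost-fullness in general. The bases have to
-- be computed, since the algorithm must decide whether a reducing g exists. Dickson's lemma bounds
-- the number of minimal points without producing them; they come instead from a constructive form
-- of Gordan's lemma, which eliminates one equation at a time. In the correctness argument one g has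
-- to lie below all points of the fiber at once. Decomposing the basis points separately could give
-- a different g for each, so they are decomposed as one family, with the same vectors of G for
-- every member.

private variable
  X X′  : Set
  R S T : Rel X 0ℓ
  d m n : ℕ

-- Almost full relations

infixl 7 _↑_

_↑_ : Rel X 0ℓ → X → Rel X 0ℓ
(R ↑ x) y z = R y z ⊎ R x y

-- After Vytiniotis, Coquand and Wahlstedt: the inductive, choice-free form of "every infinite
-- sequence has i < j with R xᵢ xⱼ".
data AF {X : Set} (R : Rel X 0ℓ) : Set₁ where
  total : (∀ x y → R x y) → AF R
  later : (∀ x → AF (R ↑ x)) → AF R

AF-mono : (∀ {x y} → R x y → S x y) → AF R → AF S
AF-mono R⊆S (total t) = total λ x y → R⊆S (t x y)
AF-mono R⊆S (later l) = later λ x → AF-mono [ inj₁ ∘ R⊆S , inj₂ ∘ R⊆S ] (l x)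

AF-on : (f : X → X′) → AF R → AF (R on f)
AF-on f (total t) = total λ x y → t (f x) (f y)
AF-on f (later l) = later λ x → AF-on f (l (f x))

private
  -- Ramsey's theorem AF-∩ is approached through weakenings of R ∩ S by a conjunction P × Q, where
  -- P and Q first depend on no argument and then on one.
  AF-⊎-const : {P Q : Set} → AF {X} R → AF {X} S →
    (∀ {x y} → R x y → T x y ⊎ P) → (∀ {x y} → S x y → T x y ⊎ Q) →
    AF (λ x y → T x y ⊎ (P × Q))
  AF-⊎-const (total r) s f g = AF-mono (λ {x} {y} q → [ inj₁ , (λ p → [ inj₁ , (λ q → inj₂ (p , q)) ] (g q)) ] (f (r x y))) s
  AF-⊎-const {X} {R = R} {T = T} {P = P} {Q = Q} (later r) s f g = later λ x → AF-mono h
      (AF-⊎-const {T = T ↑ x} (r x) s f′ (λ {y} {z} → [ inj₁ ∘ inj₁ , inj₂ ] ∘ g))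
    where
    f′ : ∀ {x y z} → (R ↑ x) y z → (T ↑ x) y z ⊎ P
    f′ (inj₁ p) = [ inj₁ ∘ inj₁ , inj₂ ] (f p)
    f′ (inj₂ p) = [ inj₁ ∘ inj₂ , inj₂ ] (f p)
    h : ∀ {x y z} → (T ↑ x) y z ⊎ (P × Q) → ((λ a b → T a b ⊎ (P × Q)) ↑ x) y z
    h (inj₁ (inj₁ t)) = inj₁ (inj₁ t)
    h (inj₁ (inj₂ t)) = inj₂ (inj₁ t)
    h (inj₂ pq) = inj₁ (inj₂ pq)

  AF-⊎-unary : {P Q : X → Set} → AF {X} R → AF {X} S →
    (∀ {x y} → R x y → T x y ⊎ P x) → (∀ {x y} → S x y → T x y ⊎ Q x) →
    AF (λ x y → T x y ⊎ (P x × Q x))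
  AF-⊎-unary (total r) s f g =
    AF-mono (λ {x} {y} q → [ inj₁ , (λ p → [ inj₁ , (λ q → inj₂ (p , q)) ] (g q)) ] (f (r x y))) s
  AF-⊎-unary r@(later _) (total s) f g =
    AF-mono (λ {x} {y} p → [ inj₁ , (λ p → [ inj₁ , (λ q → inj₂ (p , q)) ] (g (s x y))) ] (f p)) r
  AF-⊎-unary {X} {R = R} {S = S} {T = T} {P = P} {Q = Q} (later r) (later s) f g = later λ x →
    -- Once x is fixed, `P x` and `Q x` are propositions without arguments. `left` advances only r
    -- and `right` only s, each at the price of one of them; `AF-⊎-const` joins the two prices.
    AF-mono (h x) (AF-⊎-const {P = P x} {Q = Q x} (left x) (right x) (λ {y} {z} → k₁ x) (λ {y} {z} → k₂ x))
    where
    U : X → Rel X 0ℓ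
    U x y z = (T ↑ x) y z ⊎ (P y × Q y)
    left : ∀ x → AF (λ y z → ((T ↑ x) y z ⊎ P x) ⊎ (P y × Q y))
    left x = AF-⊎-unary {T = λ y z → (T ↑ x) y z ⊎ P x} (r x) (later s) f₁ g₁
      where
      f₁ : ∀ {y z} → (R ↑ x) y z → ((T ↑ x) y z ⊎ P x) ⊎ P y
      f₁ (inj₁ p) = [ inj₁ ∘ inj₁ ∘ inj₁ , inj₂ ] (f p)
      f₁ (inj₂ p) = [ inj₁ ∘ inj₁ ∘ inj₂ , inj₁ ∘ inj₂ ] (f p)
      g₁ : ∀ {y z} → S y z → ((T ↑ x) y z ⊎ P x) ⊎ Q y
      g₁ p = [ inj₁ ∘ inj₁ ∘ inj₁ , inj₂ ] (g p)
    right : ∀ x → AF (λ y z → ((T ↑ x) y z ⊎ Q x) ⊎ (P y × Q y))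
    right x = AF-⊎-unary {T = λ y z → (T ↑ x) y z ⊎ Q x} (later r) (s x) f₁ g₁
      where
      g₁ : ∀ {y z} → (S ↑ x) y z → ((T ↑ x) y z ⊎ Q x) ⊎ Q y
      g₁ (inj₁ p) = [ inj₁ ∘ inj₁ ∘ inj₁ , inj₂ ] (g p)
      g₁ (inj₂ p) = [ inj₁ ∘ inj₁ ∘ inj₂ , inj₁ ∘ inj₂ ] (g p)
      f₁ : ∀ {y z} → R y z → ((T ↑ x) y z ⊎ Q x) ⊎ P y
      f₁ p = [ inj₁ ∘ inj₁ ∘ inj₁ , inj₂ ] (f p)
    k₁ : ∀ x {y z} → ((T ↑ x) y z ⊎ P x) ⊎ (P y × Q y) → U x y z ⊎ P x
    k₁ x (inj₁ (inj₁ t)) = inj₁ (inj₁ t)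
    k₁ x (inj₁ (inj₂ p)) = inj₂ p
    k₁ x (inj₂ pq) = inj₁ (inj₂ pq)
    k₂ : ∀ x {y z} → ((T ↑ x) y z ⊎ Q x) ⊎ (P y × Q y) → U x y z ⊎ Q x
    k₂ x (inj₁ (inj₁ t)) = inj₁ (inj₁ t)
    k₂ x (inj₁ (inj₂ p)) = inj₂ p
    k₂ x (inj₂ pq) = inj₁ (inj₂ pq)
    h : ∀ x {y z} → U x y z ⊎ (P x × Q x) → ((λ a b → T a b ⊎ (P a × Q a)) ↑ x) y z
    h x (inj₁ (inj₁ (inj₁ t))) = inj₁ (inj₁ t)
    h x (inj₁ (inj₁ (inj₂ t))) = inj₂ (inj₁ t)
    h x (inj₁ (inj₂ pq)) = inj₁ (inj₂ pq)
    h x (inj₂ pq) = inj₂ (inj₂ pq)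

-- Advancing one proof past x admits the error `R x y`, advancing the other admits `S x y`; both
-- depend on y alone. `AF-⊎-unary` joins them to `R x y × S x y`, which is what the intersection
-- allows after x.
AF-∩ : AF R → AF S → AF (λ x y → R x y × S x y)
AF-∩ (total r) s = AF-mono (λ {x} {y} q → r x y , q) s
AF-∩ r@(later _) (total s) = AF-mono (λ {x} {y} p → p , s x y) r
AF-∩ {R = R} {S = S} (later r) (later s) = later λ x →
  AF-mono (λ { (inj₁ rs) → inj₁ rs ; (inj₂ rs) → inj₂ rs })
    (AF-⊎-unary {T = λ y z → R y z × S y z} {P = R x} {Q = S x} (left x) (right x) (k₁ x) (k₂ x))
  where
  left : ∀ x → AF (λ y z → (R ↑ x) y z × S y z)
  left x = AF-∩ (r x) (later s)
  right : ∀ x → AF (λ y z → R y z × (S ↑ x) y z)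
  right x = AF-∩ (later r) (s x)
  k₁ : ∀ x {y z} → (R ↑ x) y z × S y z → (R y z × S y z) ⊎ R x y
  k₁ x (inj₁ p , q) = inj₁ (p , q)
  k₁ x (inj₂ p , q) = inj₂ p
  k₂ : ∀ x {y z} → R y z × (S ↑ x) y z → (R y z × S y z) ⊎ S x y
  k₂ x (p , inj₁ q) = inj₁ (p , q)
  k₂ x (p , inj₂ q) = inj₂ q

data _≤∞_ : Rel (Maybe ℕ) 0ℓ where
  ≤nothing : ∀ {x} → x ≤∞ nothing
  ≤just    : ∀ {m n} → m ≤ℕ n → just m ≤∞ just n

-- Two occurrences of `nothing`, the infinite bound, already form a good pair. After a finite m each
-- further entry is either at least m, which is good, or smaller, which is the case of a smaller m.
AF-≤∞ : AF _≤∞_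
AF-≤∞ = later λ { (just m) → finite m ; nothing → later λ
    { (just m) → AF-mono [ inj₁ ∘ inj₁ , inj₂ ∘ inj₁ ] (finite m)
    ; nothing  → total λ _ _ → inj₂ (inj₂ ≤nothing) } }
  where
  finite : ∀ m → AF (_≤∞_ ↑ just m)
  finite zero = total λ { (just _) _ → inj₂ (≤just z≤n) ; nothing _ → inj₂ ≤nothing }
  finite (suc m) = later λ
    { nothing  → total λ _ _ → inj₂ (inj₂ ≤nothing)
    ; (just k) → case k }
    where
    case : ∀ k → AF (_≤∞_ ↑ just (suc m) ↑ just k)
    case k with k ℕP.≤? m
    ... | yes k≤m = AF-mono [ inj₁ ∘ inj₁ , (λ m≤ → inj₂ (inj₁ (weaken m≤))) ] (finite m)
      where
      weaken : ∀ {y} → just m ≤∞ y → just k ≤∞ y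
      weaken ≤nothing = ≤nothing
      weaken (≤just p) = ≤just (ℕP.≤-trans k≤m p)
    ... | no k≰m = total λ _ _ → inj₂ (inj₂ (≤just (ℕP.≰⇒> k≰m)))

AF-pointwise : AF R → ∀ m → AF {Fin m → X} (λ f g → ∀ i → R (f i) (g i))
AF-pointwise r zero    = total λ _ _ ()
AF-pointwise r (suc m) = AF-mono (λ { (p , q) zero → p ; (p , q) (suc i) → q i })
  (AF-∩ (AF-on (λ f → f zero) r) (AF-on (_∘ suc) (AF-pointwise r m)))

Hoare : Rel X 0ℓ → Rel (List X) 0ℓ
Hoare R as bs = All (λ a → Any (R a) bs) as

-- A failing step as → bs has an a ∈ as below nothing in bs, and on such bs the relation
-- R ↑ a coincides with R; hence ⋂ₐ Hoare (R ↑ a) ⊆ Hoare R ↑ as.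
AF-Hoare : AF R → AF (Hoare R)
-- For total R only an empty list on the right can spoil a comparison, and an empty list is itself
-- below everything; two entries of a sequence therefore suffice.
AF-Hoare {R = R} (total r) = later λ
  { []       → total λ _ _ → inj₂ []
  ; (a ∷ as) → later λ
    { []       → total λ _ _ → inj₂ (inj₁ [])
    ; (b ∷ bs) → total λ _ _ → inj₂ (inj₂ (All.universal (λ x → here (r x b)) (a ∷ as))) } }
AF-Hoare {X} {R = R} (later r) = later go
  where
  step : ∀ {a bs cs} → Hoare (R ↑ a) bs cs → Hoare R bs cs ⊎ Any (R a) bs
  step [] = inj₁ []
  step (p ∷ ps) with step ps
  ... | inj₂ q = inj₂ (there q)
  ... | inj₁ q = [ (λ p → inj₁ (p ∷ q)) , (λ p → inj₂ (here p)) ] (split p)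
    where
    split : ∀ {a b cs} → Any ((R ↑ a) b) cs → Any (R b) cs ⊎ R a b
    split (here (inj₁ x)) = inj₁ (here x)
    split (here (inj₂ x)) = inj₂ x
    split (there p) = [ inj₁ ∘ there , inj₂ ] (split p)
  go : ∀ as → AF (Hoare R ↑ as)
  go [] = total λ _ _ → inj₂ []
  go (a ∷ as) = AF-mono merge (AF-∩ (AF-Hoare (r a)) (go as))
    where
    merge : ∀ {bs cs} → Hoare (R ↑ a) bs cs × (Hoare R ↑ as) bs cs → (Hoare R ↑ (a ∷ as)) bs cs
    merge (p , inj₁ q) = inj₁ q
    merge (p , inj₂ q) = [ inj₁ , (λ x → inj₂ (x ∷ q)) ] (step p)

-- Finite generation of kernels in commutative monoids

◃-distrib-+ : ∀ s m n → (s ◃ m) +ℤ (s ◃ n) ≡ s ◃ (m +ℕ n)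
◃-distrib-+ Sign.+ m n = begin
  (Sign.+ ◃ m) +ℤ (Sign.+ ◃ n) ≡⟨ ≡.cong₂ _+ℤ_ (ℤP.+◃n≡+n m) (ℤP.+◃n≡+n n) ⟩
  + (m +ℕ n)                   ≡⟨ ℤP.+◃n≡+n (m +ℕ n) ⟨
  Sign.+ ◃ (m +ℕ n)            ∎
  where open ≡-Reasoning
◃-distrib-+ Sign.- m n = begin
  (Sign.- ◃ m) +ℤ (Sign.- ◃ n) ≡⟨ ≡.cong₂ _+ℤ_ (ℤP.-◃n≡-n m) (ℤP.-◃n≡-n n) ⟩
  -ℤ + m +ℤ -ℤ + n             ≡⟨ ℤP.neg-distrib-+ (+ m) (+ n) ⟨
  -ℤ + (m +ℕ n)                ≡⟨ ℤP.-◃n≡-n (m +ℕ n) ⟨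
  Sign.- ◃ (m +ℕ n)            ∎
  where open ≡-Reasoning

module FinitelyGenerated (M : CommutativeMonoid 0ℓ 0ℓ) where

  open CommutativeMonoid M
  open Mult M using () renaming (_×_ to _·_; ×-homo-+ to ·-homo-+)
  open MonoidMorphisms rawMonoid ℤ.+-0-rawMonoid using (IsMonoidHomomorphism)
  open CMSolver M using (solve; _⊜_; _⊕_)

  data Gen (R : List Carrier) : Pred Carrier 0ℓ where
    nil  : ∀ {x} → x ≈ ε → Gen R x
    cons : ∀ {x r y} → r ∈ R → Gen R y → x ≈ r ∙ y → Gen R x

  Gen-resp : ∀ {R x y} → x ≈ y → Gen R y → Gen R x
  Gen-resp p (nil q)      = nil (trans p q)
  Gen-resp p (cons r g q) = cons r g (trans p q)

  Gen-⊆ : ∀ {R S} → (∀ {r} → r ∈ R → r ∈ S) → Gen R ⊆ Gen S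
  Gen-⊆ R⊆S (nil p)      = nil p
  Gen-⊆ R⊆S (cons r g p) = cons (R⊆S r) (Gen-⊆ R⊆S g) p

  Gen-∙ : ∀ {R x y} → Gen R x → Gen R y → Gen R (x ∙ y)
  Gen-∙ (nil p)      h = Gen-resp (trans (∙-congʳ p) (identityˡ _)) h
  Gen-∙ (cons r g p) h = cons r (Gen-∙ g h) (trans (∙-congʳ p) (assoc _ _ _))

  Gen-· : ∀ {R x} a → Gen R x → Gen R (a · x)
  Gen-· zero    g = nil refl
  Gen-· (suc a) g = Gen-∙ g (Gen-· a g)

  Gen-∈ : ∀ {R r} → r ∈ R → Gen R r
  Gen-∈ r = cons r (nil refl) (sym (identityʳ _))

  -- Combinations with one explicit multiplicity per list entry. The elimination below bounds
  -- multiplicities, which `Gen` does not expose.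
  Lin : List Carrier → Pred Carrier 0ℓ
  Lin []      x = x ≈ ε
  Lin (h ∷ H) x = ∃[ a ] ∃[ y ] (Lin H y × x ≈ (a · h) ∙ y)

  Lin-resp : ∀ H {x y} → x ≈ y → Lin H y → Lin H x
  Lin-resp []      p q           = trans p q
  Lin-resp (h ∷ H) p (a , y , l , q) = a , y , l , trans p q

  Lin-ε : ∀ H → Lin H ε
  Lin-ε []      = refl
  Lin-ε (h ∷ H) = 0 , ε , Lin-ε H , sym (identityˡ ε)

  Lin-∈ : ∀ {H h y} → h ∈ H → Lin H y → Lin H (h ∙ y)
  Lin-∈ (here ≡.refl) (a , y , l , p) = suc a , y , l , trans (∙-congˡ p) (sym (assoc _ _ _))
  Lin-∈ {k ∷ H} {h} (there h∈) (a , y , l , p) = a , h ∙ y , Lin-∈ h∈ l ,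
    trans (∙-congˡ p) (solve 3 (λ h k y → (h ⊕ (k ⊕ y)) ⊜ (k ⊕ (h ⊕ y))) refl h (a · k) y)

  Gen⇒Lin : ∀ {H} → Gen H ⊆ Lin H
  Gen⇒Lin {H} (nil p)      = Lin-resp H p (Lin-ε H)
  Gen⇒Lin {H} (cons r g p) = Lin-resp H p (Lin-∈ r (Gen⇒Lin g))

  Lin⇒Gen : ∀ H → Lin H ⊆ Gen H
  Lin⇒Gen []      p               = nil p
  Lin⇒Gen (h ∷ H) (a , y , l , p) =
    Gen-resp p (Gen-∙ (Gen-· a (Gen-∈ (here ≡.refl))) (Gen-⊆ there (Lin⇒Gen H l)))

  -- The generators lie in K but only Q must be generated. Q may thus be a slice that is no
  -- submonoid, and a kernel can be assembled from finitely many slices.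
  FG : Pred Carrier 0ℓ → Pred Carrier 0ℓ → Set
  FG K Q = ∃[ R ] (All K R × Q ⊆ Gen R)

  FG-⊆ : ∀ {K Q Q′} → Q′ ⊆ Q → FG K Q → FG K Q′
  FG-⊆ Q′⊆Q (R , KR , gen) = R , KR , gen ∘ Q′⊆Q

  FG-∪ : ∀ {K Q Q′} → FG K Q → FG K Q′ → FG K (λ x → Q x ⊎ Q′ x)
  FG-∪ (R , KR , gen) (R′ , KR′ , gen′) = R ++ R′ , AllP.++⁺ KR KR′ ,
    [ Gen-⊆ ∈-++⁺ˡ ∘ gen , Gen-⊆ (∈-++⁺ʳ R) ∘ gen′ ]

  FG-⋃ : ∀ {K} {Q : ℕ → Pred Carrier 0ℓ} n → (∀ a → FG K (Q a)) → FG K (λ x → ∃[ a ] (a < n × Q a x))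
  FG-⋃ zero    f = [] , [] , λ { (_ , () , _) }
  FG-⋃ {Q = Q} (suc n) f = FG-⊆ case (FG-∪ (f n) (FG-⋃ n f))
    where
    case : ∀ {x} → ∃[ a ] (a < suc n × Q a x) → Q n x ⊎ (∃[ a ] (a < n × Q a x))
    case (a , s≤s a≤n , q) with ℕP.m≤n⇒m<n∨m≡n a≤n
    ... | inj₁ a<n    = inj₂ (a , a<n , q)
    ... | inj₂ ≡.refl = inj₁ q

  record Submonoid (V : Pred Carrier 0ℓ) : Set where
    field
      ε∈ : V ε
      ∙∈ : ∀ {x y} → V x → V y → V (x ∙ y)

    ·∈ : ∀ {x} a → V x → V (a · x)
    ·∈ zero    _ = ε∈
    ·∈ (suc a) v = ∙∈ v (·∈ a v)

  -- Adjoining one linear equation to a finitely generated submonoid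

  module Row {φ : Carrier → ℤ} (φ-hom : IsMonoidHomomorphism φ)
             {V : Pred Carrier 0ℓ} (V-sub : Submonoid V) where

    open IsMonoidHomomorphism φ-hom
    open Submonoid V-sub

    K : Pred Carrier 0ℓ
    K x = V x × φ x ≡ 0ℤ

    φ-· : ∀ s p a h → φ h ≡ s ◃ p → φ (a · h) ≡ s ◃ (a *ℕ p)
    φ-· s p zero    h eq = ε-homo
    φ-· s p (suc a) h eq = begin
      φ (h ∙ a · h)            ≡⟨ homo h (a · h) ⟩
      φ h +ℤ φ (a · h)         ≡⟨ ≡.cong₂ _+ℤ_ eq (φ-· s p a h eq) ⟩
      (s ◃ p) +ℤ (s ◃ a *ℕ p)  ≡⟨ ◃-distrib-+ s p (a *ℕ p) ⟩
      s ◃ (p +ℕ a *ℕ p)        ∎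
      where open ≡-Reasoning

    Signed : Sign → Pred Carrier 0ℓ
    Signed s h = V h × ∃[ p ] φ h ≡ s ◃ suc p

    φ-Lin : ∀ {s} H → All (Signed s) H → ∀ {y} → Lin H y → ∃[ k ] φ y ≡ s ◃ k
    φ-Lin []      []                   p = 0 , ≡.trans (⟦⟧-cong p) ε-homo
    φ-Lin {s} (h ∷ H) ((_ , p , eq) ∷ ps) {x} (a , y , l , x≈) with φ-Lin H ps l
    ... | k , eq′ = a *ℕ suc p +ℕ k , (begin
      φ x                            ≡⟨ ⟦⟧-cong x≈ ⟩
      φ (a · h ∙ y)                  ≡⟨ homo (a · h) y ⟩
      φ (a · h) +ℤ φ y               ≡⟨ ≡.cong₂ _+ℤ_ (φ-· s (suc p) a h eq) eq′ ⟩
      (s ◃ a *ℕ suc p) +ℤ (s ◃ k)    ≡⟨ ◃-distrib-+ s (a *ℕ suc p) k ⟩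
      s ◃ (a *ℕ suc p +ℕ k)          ∎)
      where open ≡-Reasoning

    OneSided : Carrier → List Carrier → Pred Carrier 0ℓ
    OneSided c P x = ∃[ y ] (Lin P y × x ≈ c ∙ y × φ x ≡ 0ℤ)

    -- All values `φ h` have the same sign, so they cannot cancel each other and must together
    -- cancel `φ c`. Each multiplicity is hence at most `∣ φ c ∣`; its finitely many values are
    -- moved into the offset.
    oneSided : ∀ {s} c → V c → ∀ P → All (Signed s) P → FG K (OneSided c P)
    oneSided c Vc [] [] with φ c ℤP.≟ 0ℤ
    ... | yes φc≡0 = c ∷ [] , (Vc , φc≡0) ∷ [] ,
      λ { (y , y≈ε , x≈ , _) → cons (here ≡.refl) (nil y≈ε) x≈ }
    ... | no φc≢0 = [] , [] , λ { (y , y≈ε , x≈ , φx≡0) → contradiction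
      (≡.trans (≡.sym (⟦⟧-cong (trans x≈ (trans (∙-congˡ y≈ε) (identityʳ c))))) φx≡0) φc≢0 }
    oneSided {s} c Vc (h ∷ P) ((Vh , p , eq) ∷ ps) = FG-⊆ bound
      (FG-⋃ (suc ∣ φ c ∣) λ a → oneSided (c ∙ a · h) (∙∈ Vc (·∈ a Vh)) P ps)
      where
      bound : ∀ {x} → OneSided c (h ∷ P) x → ∃[ a ] (a < suc ∣ φ c ∣ × OneSided (c ∙ a · h) P x)
      bound {x} (z , l@(a , y , lin , z≈) , x≈ , φx≡0) with φ-Lin (h ∷ P) ((Vh , p , eq) ∷ ps) l
                                                        | φ-Lin P ps lin
      ... | k , φz≡ | m , φy≡ = a , s≤s a≤ , y , lin ,
        trans x≈ (trans (∙-congˡ z≈) (sym (assoc _ _ _))) , φx≡0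
        where
        open ≡-Reasoning
        k≡ : k ≡ a *ℕ suc p +ℕ m
        k≡ = ≡.trans (≡.sym (ℤP.abs-◃ s k)) (≡.trans (≡.cong ∣_∣ (begin
          s ◃ k                        ≡⟨ φz≡ ⟨
          φ z                          ≡⟨ ⟦⟧-cong z≈ ⟩
          φ (a · h ∙ y)                ≡⟨ homo (a · h) y ⟩
          φ (a · h) +ℤ φ y             ≡⟨ ≡.cong₂ _+ℤ_ (φ-· s (suc p) a h eq) φy≡ ⟩
          (s ◃ a *ℕ suc p) +ℤ (s ◃ m)  ≡⟨ ◃-distrib-+ s (a *ℕ suc p) m ⟩
          s ◃ (a *ℕ suc p +ℕ m)        ∎)) (ℤP.abs-◃ s (a *ℕ suc p +ℕ m)))
        φc≡ : φ c ≡ -ℤ φ z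
        φc≡ = begin
          φ c                       ≡⟨ ℤP.+-identityʳ (φ c) ⟨
          φ c +ℤ 0ℤ                 ≡⟨ ≡.cong (φ c +ℤ_) (ℤP.+-inverseʳ (φ z)) ⟨
          φ c +ℤ (φ z +ℤ -ℤ φ z)    ≡⟨ ℤP.+-assoc (φ c) (φ z) (-ℤ φ z) ⟨
          φ c +ℤ φ z +ℤ -ℤ φ z      ≡⟨ ≡.cong (_+ℤ -ℤ φ z) (homo c z) ⟨
          φ (c ∙ z) +ℤ -ℤ φ z       ≡⟨ ≡.cong (_+ℤ -ℤ φ z) (≡.trans (≡.sym (⟦⟧-cong x≈)) φx≡0) ⟩
          0ℤ +ℤ -ℤ φ z              ≡⟨ ℤP.+-identityˡ _ ⟩
          -ℤ φ z                    ∎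
        ∣φc∣≡ : ∣ φ c ∣ ≡ k
        ∣φc∣≡ = begin
          ∣ φ c ∣       ≡⟨ ≡.cong ∣_∣ φc≡ ⟩
          ∣ -ℤ φ z ∣    ≡⟨ ℤP.∣-i∣≡∣i∣ (φ z) ⟩
          ∣ φ z ∣       ≡⟨ ≡.cong ∣_∣ φz≡ ⟩
          ∣ s ◃ k ∣     ≡⟨ ℤP.abs-◃ s k ⟩
          k             ∎
        a≤ : a ≤ℕ ∣ φ c ∣
        a≤ = ≡.subst (a ≤ℕ_) (≡.sym (≡.trans ∣φc∣≡ k≡))
               (ℕP.≤-trans (ℕP.m≤m*n a (suc p)) (ℕP.m≤m+n (a *ℕ suc p) m))

    TwoSided : Carrier → (P N : List Carrier) → Pred Carrier 0ℓ
    TwoSided c P N x = ∃[ y ] ∃[ z ] (Lin P y × Lin N z × x ≈ c ∙ (y ∙ z) × φ x ≡ 0ℤ)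

    -- If φ h = p > 0 and φ k = −q < 0, then q·h + p·k lies in the kernel and can be split off as
    -- long as h occurs at least q times and k at least p times.  Afterwards one of the two
    -- multiplicities is bounded; its finitely many values are moved into the offset c.
    reducePair : ∀ {c h k P N} → Signed Sign.+ h → Signed Sign.- k →
      (∀ a → FG K (TwoSided (c ∙ a · h) P (k ∷ N))) → (∀ b → FG K (TwoSided (c ∙ b · k) (h ∷ P) N)) →
      FG K (TwoSided c (h ∷ P) (k ∷ N))
    reducePair {c} {h} {k} {P} {N} (Vh , p , eqh) (Vk , q , eqk) fewH fewK =
      r ∷ gens , (∙∈ (·∈ (suc q) Vh) (·∈ (suc p) Vk) , φr≡0) ∷ KR ,
      λ { {x} (y , z , (a , y′ , ly , y≈) , (b , z′ , lz , z≈) , x≈ , φx≡0) →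
          split a b (<-wellFounded a) ly lz (trans x≈ (∙-congˡ (∙-cong y≈ z≈))) φx≡0 }
      where
      r : Carrier
      r = suc q · h ∙ suc p · k
      φr≡0 : φ r ≡ 0ℤ
      φr≡0 = begin
        φ r                                                    ≡⟨ homo (suc q · h) (suc p · k) ⟩
        φ (suc q · h) +ℤ φ (suc p · k)                         ≡⟨ ≡.cong₂ _+ℤ_ (φ-· Sign.+ (suc p) (suc q) h eqh) (φ-· Sign.- (suc q) (suc p) k eqk) ⟩
        + (suc q *ℕ suc p) +ℤ -ℤ + (suc p *ℕ suc q)            ≡⟨ ≡.cong (λ m → + (suc q *ℕ suc p) +ℤ -ℤ + m) (ℕP.*-comm (suc p) (suc q)) ⟩
        + (suc q *ℕ suc p) +ℤ -ℤ + (suc q *ℕ suc p)            ≡⟨ ℤP.+-inverseʳ (+ (suc q *ℕ suc p)) ⟩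
        0ℤ                                                     ∎
        where open ≡-Reasoning
      few = FG-∪ (FG-⋃ (suc q) fewH) (FG-⋃ (suc p) fewK)
      gens = proj₁ few
      KR = proj₁ (proj₂ few)
      gen = proj₂ (proj₂ few)
      split : ∀ a b {x y z} → Acc _<_ a → Lin P y → Lin N z →
              x ≈ c ∙ ((a · h ∙ y) ∙ (b · k ∙ z)) → φ x ≡ 0ℤ → Gen (r ∷ gens) x
      split a b {x} {y} {z} (acc rec) ly lz x≈ φx≡0 with a ℕP.<? suc q | b ℕP.<? suc p
      ... | yes a<q | _ = Gen-⊆ there (gen (inj₁ (a , a<q , y , _ , ly , (b , z , lz , refl) , trans x≈
              (solve 4 (λ c h y z → (c ⊕ ((h ⊕ y) ⊕ z)) ⊜ ((c ⊕ h) ⊕ (y ⊕ z))) refl c (a · h) y (b · k ∙ z)) , φx≡0)))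
      ... | no _ | yes b<p = Gen-⊆ there (gen (inj₂ (b , b<p , _ , z , (a , y , ly , refl) , lz , trans x≈
              (solve 4 (λ c y k z → (c ⊕ (y ⊕ (k ⊕ z))) ⊜ ((c ⊕ k) ⊕ (y ⊕ z))) refl c (a · h ∙ y) (b · k) z) , φx≡0)))
      ... | no a≮q | no b≮p with ℕP.m≤n⇒∃[o]m+o≡n (ℕP.≮⇒≥ a≮q) | ℕP.m≤n⇒∃[o]m+o≡n (ℕP.≮⇒≥ b≮p)
      ...   | a′ , ≡.refl | b′ , ≡.refl =
        cons (here ≡.refl) (split a′ b′ (rec (s≤s (ℕP.m≤n+m a′ q))) ly lz refl φx′≡0) x≈rx′
        where
        x′ : Carrier
        x′ = c ∙ ((a′ · h ∙ y) ∙ (b′ · k ∙ z))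
        x≈rx′ : x ≈ r ∙ x′
        x≈rx′ = trans x≈ (trans (∙-congˡ (∙-cong (∙-congʳ (·-homo-+ h (suc q) a′)) (∙-congʳ (·-homo-+ k (suc p) b′))))
          (solve 7 (λ c qh a′h pk b′k y z → (c ⊕ (((qh ⊕ a′h) ⊕ y) ⊕ ((pk ⊕ b′k) ⊕ z)))
                       ⊜ ((qh ⊕ pk) ⊕ (c ⊕ ((a′h ⊕ y) ⊕ (b′k ⊕ z)))))
                 refl c (suc q · h) (a′ · h) (suc p · k) (b′ · k) y z))
        φx′≡0 : φ x′ ≡ 0ℤ
        φx′≡0 = begin
          φ x′              ≡⟨ ℤP.+-identityˡ (φ x′) ⟨
          0ℤ +ℤ φ x′        ≡⟨ ≡.cong (_+ℤ φ x′) φr≡0 ⟨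
          φ r +ℤ φ x′       ≡⟨ homo r x′ ⟨
          φ (r ∙ x′)        ≡⟨ ⟦⟧-cong x≈rx′ ⟨
          φ x               ≡⟨ φx≡0 ⟩
          0ℤ                ∎
          where open ≡-Reasoning

    -- Each use of `reducePair` shortens P or N, until values of one sign only are left.
    twoSided : ∀ c → V c → ∀ P N → All (Signed Sign.+) P → All (Signed Sign.-) N → FG K (TwoSided c P N)
    twoSided c Vc [] N [] ns = FG-⊆
      (λ { (y , z , y≈ε , l , x≈ , φx) → z , l , trans x≈ (∙-congˡ (trans (∙-congʳ y≈ε) (identityˡ z))) , φx })
      (oneSided c Vc N ns)
    twoSided c Vc P@(_ ∷ _) [] ps [] = FG-⊆
      (λ { (y , z , l , z≈ε , x≈ , φx) → y , l , trans x≈ (∙-congˡ (trans (∙-congˡ z≈ε) (identityʳ y))) , φx })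
      (oneSided {Sign.+} c Vc P ps)
    twoSided c Vc (h ∷ P) (k ∷ N) ps₀@(sh ∷ ps) ns₀@(sk ∷ ns) = reducePair {P = P} {N} sh sk
      (λ a → twoSided (c ∙ a · h) (∙∈ Vc (·∈ a (proj₁ sh))) P (k ∷ N) ps ns₀)
      (λ b → twoSided (c ∙ b · k) (∙∈ Vc (·∈ b (proj₁ sk))) (h ∷ P) N ps₀ ns)

    record Split (H : List Carrier) : Set where
      field
        {P N Z} : List Carrier
        P+ : All (Signed Sign.+) P
        N- : All (Signed Sign.-) N
        Z0 : All K Z
        parts : ∀ {x} → Lin H x → ∃[ u ] ∃[ v ] ∃[ w ] (Lin P u × Lin N v × Lin Z w × x ≈ (u ∙ v) ∙ w)

    split : ∀ H → All V H → Split H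
    split [] [] = record { P+ = [] ; N- = [] ; Z0 = []
      ; parts = λ p → ε , ε , ε , refl , refl , refl , trans p (sym (trans (identityʳ _) (identityʳ _))) }
    split (h ∷ H) (Vh ∷ VH) with split H VH | φ h in eq
    ... | s | + zero = record { P+ = P+ ; N- = N- ; Z0 = (Vh , eq) ∷ Z0 ; parts = λ
          { (a , y , l , x≈) → let u , v , w , lu , lv , lw , y≈ = parts l in
            u , v , a · h ∙ w , lu , lv , (a , w , lw , refl) , trans x≈ (trans (∙-congˡ y≈)
            (solve 4 (λ h u v w → (h ⊕ ((u ⊕ v) ⊕ w)) ⊜ ((u ⊕ v) ⊕ (h ⊕ w))) refl (a · h) u v w)) } }
      where open Split s
    ... | s | + suc p = record { P+ = (Vh , p , eq) ∷ P+ ; N- = N- ; Z0 = Z0 ; parts = λ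
          { (a , y , l , x≈) → let u , v , w , lu , lv , lw , y≈ = parts l in
            a · h ∙ u , v , w , (a , u , lu , refl) , lv , lw , trans x≈ (trans (∙-congˡ y≈)
            (solve 4 (λ h u v w → (h ⊕ ((u ⊕ v) ⊕ w)) ⊜ (((h ⊕ u) ⊕ v) ⊕ w)) refl (a · h) u v w)) } }
      where open Split s
    ... | s | -[1+ q ] = record { P+ = P+ ; N- = (Vh , q , eq) ∷ N- ; Z0 = Z0 ; parts = λ
          { (a , y , l , x≈) → let u , v , w , lu , lv , lw , y≈ = parts l in
            u , a · h ∙ v , w , lu , (a , v , lv , refl) , lw , trans x≈ (trans (∙-congˡ y≈)
            (solve 4 (λ h u v w → (h ⊕ ((u ⊕ v) ⊕ w)) ⊜ ((u ⊕ (h ⊕ v)) ⊕ w)) refl (a · h) u v w)) } }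
      where open Split s

    φ-Gen-K : ∀ {Z x} → All K Z → Gen Z x → φ x ≡ 0ℤ
    φ-Gen-K Z0 (nil p)      = ≡.trans (⟦⟧-cong p) ε-homo
    φ-Gen-K Z0 (cons r g p) = ≡.trans (⟦⟧-cong p) (≡.trans (homo _ _)
      (≡.cong₂ _+ℤ_ (proj₂ (All.lookup Z0 r)) (φ-Gen-K Z0 g)))

    -- Generators on which φ vanishes are in the kernel already. Removing their contribution from x
    -- keeps the value zero and leaves a two-sided combination with trivial offset.
    kernel : ∀ {Q} → FG V Q → FG K (λ x → Q x × φ x ≡ 0ℤ)
    kernel {Q} (H , VH , gen) = gens ++ Z , AllP.++⁺ KR Z0 , go
      where
      open Split (split H VH)
      two = twoSided ε ε∈ P N P+ N-
      gens = proj₁ two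
      KR = proj₁ (proj₂ two)
      go : ∀ {x} → Q x × φ x ≡ 0ℤ → Gen (gens ++ Z) x
      go {x} (q , φx≡0) with parts (Gen⇒Lin (gen q))
      ... | u , v , w , lu , lv , lw , x≈ = Gen-resp x≈
            (Gen-∙ (Gen-⊆ ∈-++⁺ˡ (proj₂ (proj₂ two) (u , v , lu , lv , sym (identityˡ _) , φuv≡0)))
                   (Gen-⊆ (∈-++⁺ʳ gens) gw))
        where
        gw = Lin⇒Gen Z lw
        φuv≡0 : φ (u ∙ v) ≡ 0ℤ
        φuv≡0 = begin
          φ (u ∙ v)          ≡⟨ ℤP.+-identityʳ _ ⟨
          φ (u ∙ v) +ℤ 0ℤ    ≡⟨ ≡.cong (φ (u ∙ v) +ℤ_) (φ-Gen-K Z0 gw) ⟨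
          φ (u ∙ v) +ℤ φ w   ≡⟨ homo (u ∙ v) w ⟨
          φ ((u ∙ v) ∙ w)    ≡⟨ ⟦⟧-cong x≈ ⟨
          φ x                ≡⟨ φx≡0 ⟩
          0ℤ                 ∎
          where open ≡-Reasoning

  -- Gordan's lemma over a finitely generated submonoid: the solutions of the remaining equations
  -- form a finitely generated submonoid, to which one more equation is adjoined.
  commonKernel : ∀ {U} → FG U U → Submonoid U → ∀ {d} (φ : Fin d → Carrier → ℤ) →
    (∀ i → IsMonoidHomomorphism (φ i)) →
    let Ker = λ x → U x × (∀ i → φ i x ≡ 0ℤ) in FG Ker Ker
  commonKernel (H , UH , gen) sub {zero}  φ hom = H , All.map (λ u → u , λ ()) UH , gen ∘ proj₁
  commonKernel {U} fg sub {suc d} φ hom =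
    let R , KR , gen = Row.kernel (hom zero) Ker-sub (commonKernel fg sub (φ ∘ suc) (hom ∘ suc))
    in R , All.map (λ { ((u , k) , k₀) → u , λ { zero → k₀ ; (suc i) → k i } }) KR ,
       λ { (u , k) → gen ((u , k ∘ suc) , k zero) }
    where
    module Hom i = IsMonoidHomomorphism (hom i)
    module Sub = Submonoid sub
    Ker-sub : Submonoid (λ x → U x × (∀ i → φ (suc i) x ≡ 0ℤ))
    Ker-sub = record
      { ε∈ = Sub.ε∈ , λ i → Hom.ε-homo (suc i)
      ; ∙∈ = λ { (u , k) (v , l) → Sub.∙∈ u v ,
             λ i → ≡.trans (Hom.homo (suc i) _ _) (≡.cong₂ _+ℤ_ (k i) (l i)) } }

-- Integer vectors, sign-compatibility and norms

lookup-ext : {u v : ℤ^ n} → (∀ j → lookup u j ≡ lookup v j) → u ≡ v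
lookup-ext {u = u} {v} eq = ≡.trans (≡.sym (tabulate∘lookup u)) (≡.trans (tabulate-cong eq) (tabulate∘lookup v))

lookup-+ᵛ : (u v : ℤ^ n) → ∀ j → lookup (u +ᵛ v) j ≡ lookup u j +ℤ lookup v j
lookup-+ᵛ u v j = lookup-zipWith _+ℤ_ j u v

lookup--ᵛ : (u v : ℤ^ n) → ∀ j → lookup (u -ᵛ v) j ≡ lookup u j -ℤ lookup v j
lookup--ᵛ u v j = lookup-zipWith _-ℤ_ j u v

lookup-0ᵛ : ∀ j → lookup (0ᵛ {n}) j ≡ 0ℤ
lookup-0ᵛ j = lookup-replicate j 0ℤ

+ᵛ-assoc : (u v w : ℤ^ n) → (u +ᵛ v) +ᵛ w ≡ u +ᵛ (v +ᵛ w)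
+ᵛ-assoc = zipWith-assoc ℤP.+-assoc

+ᵛ-comm : (u v : ℤ^ n) → u +ᵛ v ≡ v +ᵛ u
+ᵛ-comm = zipWith-comm ℤP.+-comm

+ᵛ-identityˡ : (u : ℤ^ n) → 0ᵛ +ᵛ u ≡ u
+ᵛ-identityˡ = zipWith-identityˡ ℤP.+-identityˡ

+ᵛ-identityʳ : (u : ℤ^ n) → u +ᵛ 0ᵛ ≡ u
+ᵛ-identityʳ = zipWith-identityʳ ℤP.+-identityʳ

u+[v-u]≡v : (u v : ℤ^ n) → u +ᵛ (v -ᵛ u) ≡ v
u+[v-u]≡v []      []      = ≡.refl
u+[v-u]≡v (x ∷ u) (y ∷ v) = ≡.cong₂ _∷_ (lemma x y) (u+[v-u]≡v u v)
  where
  lemma : ∀ x y → x +ℤ (y -ℤ x) ≡ y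
  lemma = solve-∀

[u+v]-u≡v : (u v : ℤ^ n) → (u +ᵛ v) -ᵛ u ≡ v
[u+v]-u≡v []      []      = ≡.refl
[u+v]-u≡v (x ∷ u) (y ∷ v) = ≡.cong₂ _∷_ (lemma x y) ([u+v]-u≡v u v)
  where
  lemma : ∀ x y → (x +ℤ y) -ℤ x ≡ y
  lemma = solve-∀

u-u≡0 : (u : ℤ^ n) → u -ᵛ u ≡ 0ᵛ
u-u≡0 []      = ≡.refl
u-u≡0 (x ∷ u) = ≡.cong₂ _∷_ (ℤP.+-inverseʳ x) (u-u≡0 u)

dot-+ᵛ : (a u v : ℤ^ n) → dot a (u +ᵛ v) ≡ dot a u +ℤ dot a v
dot-+ᵛ []      []      []      = ≡.refl
dot-+ᵛ (x ∷ a) (y ∷ u) (z ∷ v) = ≡.trans (≡.cong (x *ℤ (y +ℤ z) +ℤ_) (dot-+ᵛ a u v)) (lemma x y z (dot a u) (dot a v))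
  where
  lemma : ∀ x y z p q → x *ℤ (y +ℤ z) +ℤ (p +ℤ q) ≡ (x *ℤ y +ℤ p) +ℤ (x *ℤ z +ℤ q)
  lemma = solve-∀

dot-0ᵛ : (a : ℤ^ n) → dot a 0ᵛ ≡ 0ℤ
dot-0ᵛ []      = ≡.refl
dot-0ᵛ (x ∷ a) = ≡.cong₂ _+ℤ_ (ℤP.*-zeroʳ x) (dot-0ᵛ a)

dot--ᵛ : (a u : ℤ^ n) → dot a (-ᵛ u) ≡ -ℤ dot a u
dot--ᵛ []      []      = ≡.refl
dot--ᵛ (x ∷ a) (y ∷ u) = ≡.trans (≡.cong (x *ℤ (-ℤ y) +ℤ_) (dot--ᵛ a u)) (lemma x y (dot a u))
  where
  lemma : ∀ x y p → x *ℤ (-ℤ y) +ℤ -ℤ p ≡ -ℤ (x *ℤ y +ℤ p)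
  lemma = solve-∀

*ᵛ-+ᵛ : (A : Matrix d n) → ∀ u v → A *ᵛ (u +ᵛ v) ≡ A *ᵛ u +ᵛ A *ᵛ v
*ᵛ-+ᵛ []      u v = ≡.refl
*ᵛ-+ᵛ (a ∷ A) u v = ≡.cong₂ _∷_ (dot-+ᵛ a u v) (*ᵛ-+ᵛ A u v)

*ᵛ-0ᵛ : (A : Matrix d n) → A *ᵛ 0ᵛ ≡ 0ᵛ
*ᵛ-0ᵛ []      = ≡.refl
*ᵛ-0ᵛ (a ∷ A) = ≡.cong₂ _∷_ (dot-0ᵛ a) (*ᵛ-0ᵛ A)

*ᵛ--ᵛ : (A : Matrix d n) → ∀ u → A *ᵛ (-ᵛ u) ≡ -ᵛ (A *ᵛ u)
*ᵛ--ᵛ []      u = ≡.refl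
*ᵛ--ᵛ (a ∷ A) u = ≡.cong₂ _∷_ (dot--ᵛ a u) (*ᵛ--ᵛ A u)

*ᵛ-minus : (A : Matrix d n) → ∀ u v → A *ᵛ (u -ᵛ v) ≡ A *ᵛ u -ᵛ A *ᵛ v
*ᵛ-minus A u v = begin
  A *ᵛ (u -ᵛ v)                       ≡⟨ [u+v]-u≡v (A *ᵛ v) (A *ᵛ (u -ᵛ v)) ⟨
  (A *ᵛ v +ᵛ A *ᵛ (u -ᵛ v)) -ᵛ A *ᵛ v  ≡⟨ ≡.cong (_-ᵛ A *ᵛ v) (*ᵛ-+ᵛ A v (u -ᵛ v)) ⟨
  A *ᵛ (v +ᵛ (u -ᵛ v)) -ᵛ A *ᵛ v       ≡⟨ ≡.cong (λ w → A *ᵛ w -ᵛ A *ᵛ v) (u+[v-u]≡v v u) ⟩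
  A *ᵛ u -ᵛ A *ᵛ v                     ∎
  where open ≡-Reasoning

pos neg : ℤ → ℕ
pos (+ m)    = m
pos -[1+ m ] = 0
neg (+ m)    = 0
neg -[1+ m ] = suc m

∣i∣≡pos+neg : ∀ i → ∣ i ∣ ≡ pos i +ℕ neg i
∣i∣≡pos+neg (+ m)    = ≡.sym (ℕP.+-identityʳ m)
∣i∣≡pos+neg -[1+ m ] = ≡.refl

infix 4 _≼_ _≼ᵛ_

-- One coordinate of `_⊑_`, restated as two inequalities in ℕ. Transitivity and complements then
-- become plain arithmetic, without a case distinction on signs.
_≼_ : ℤ → ℤ → Set
i ≼ k = pos i ≤ℕ pos k × neg i ≤ℕ neg k

≼-intro : ∀ i k → 0ℤ ≤ℤ i *ℤ k → ∣ i ∣ ≤ℕ ∣ k ∣ → i ≼ k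
≼-intro (+ zero)  k            _  _ = z≤n , z≤n
≼-intro (+ suc m) (+ n)        _  p = p , z≤n
≼-intro (+ suc m) -[1+ n ]     () _
≼-intro -[1+ m ]  (+ zero)     _  ()
≼-intro -[1+ m ]  (+ suc n)    () _
≼-intro -[1+ m ]  -[1+ n ]     _  p = z≤n , p

≼-sign : ∀ i k → i ≼ k → 0ℤ ≤ℤ i *ℤ k
≼-sign (+ zero)  k         _        = +≤+ z≤n
≼-sign (+ suc m) (+ zero)  (() , _)
≼-sign (+ suc m) (+ suc n) _        = +≤+ z≤n
≼-sign (+ suc m) -[1+ n ]  (() , _)
≼-sign -[1+ m ]  (+ n)     (_ , ())
≼-sign -[1+ m ]  -[1+ n ]  _        = +≤+ z≤n

≼-abs : ∀ i k → i ≼ k → ∣ i ∣ ≤ℕ ∣ k ∣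
≼-abs i k (p , q) rewrite ∣i∣≡pos+neg i | ∣i∣≡pos+neg k = ℕP.+-mono-≤ p q

⊖-≼ : ∀ a b k → pos k ≡ a → neg k ≡ b → ∀ a′ b′ → a′ ≤ℕ a → b′ ≤ℕ b → (+ a′ -ℤ + b′) ≼ k
⊖-≼ a b k ≡.refl ≡.refl a′ b′ p q rewrite ℤP.m-n≡m⊖n a′ b′ = go a′ b′ p q
  where
  go : ∀ a′ b′ → a′ ≤ℕ pos k → b′ ≤ℕ neg k → (a′ ⊖ b′) ≼ k
  go a′ b′ p q with b′ ℕP.≤? a′
  ... | yes b≤a rewrite ℤP.⊖-≥ b≤a = ℕP.≤-trans (ℕP.m∸n≤m a′ b′) p , z≤n
  ... | no b≰a rewrite ℤP.⊖-< (ℕP.≰⇒> b≰a) = negative (b′ ∸ a′) (ℕP.≤-trans (ℕP.m∸n≤m b′ a′) q)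
    where
    negative : ∀ m → m ≤ℕ neg k → (-ℤ + m) ≼ k
    negative zero    _ = z≤n , z≤n
    negative (suc m) r = z≤n , r

≼-complement : ∀ i k → i ≼ k → pos k ≡ pos i +ℕ pos (k -ℤ i) × neg k ≡ neg i +ℕ neg (k -ℤ i)
≼-complement (+ m)    (+ n)     (p , _) rewrite ℤP.m-n≡m⊖n n m | ℤP.⊖-≥ p = ≡.sym (ℕP.m+[n∸m]≡n p) , ≡.refl
≼-complement (+ zero) -[1+ n ]  _       = ≡.refl , ≡.refl
≼-complement -[1+ m ] (+ n)     (_ , ())
≼-complement -[1+ m ] -[1+ n ]  (_ , s≤s q) rewrite ℤP.[1+m]⊖[1+n]≡m⊖n m n | ℤP.⊖-≤ q =
  ≡.sym (pos-neg (n ∸ m)) , ≡.cong suc (≡.trans (≡.sym (ℕP.m+[n∸m]≡n q)) (≡.cong (m +ℕ_) (≡.sym (neg-neg (n ∸ m)))))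
  where
  pos-neg : ∀ m → pos (-ℤ + m) ≡ 0
  pos-neg zero    = ≡.refl
  pos-neg (suc _) = ≡.refl
  neg-neg : ∀ m → neg (-ℤ + m) ≡ m
  neg-neg zero    = ≡.refl
  neg-neg (suc _) = ≡.refl

_≼ᵛ_ : ℤ^ n → ℤ^ n → Set
u ≼ᵛ v = ∀ j → lookup u j ≼ lookup v j

⊑⇒≼ᵛ : {u v : ℤ^ n} → u ⊑ v → u ≼ᵛ v
⊑⇒≼ᵛ u⊑v j = ≼-intro _ _ (proj₁ (u⊑v j)) (proj₂ (u⊑v j))

≼ᵛ⇒⊑ : {u v : ℤ^ n} → u ≼ᵛ v → u ⊑ v
≼ᵛ⇒⊑ u≼v j = ≼-sign _ _ (u≼v j) , ≼-abs _ _ (u≼v j)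

⊑-trans : {u v w : ℤ^ n} → u ⊑ v → v ⊑ w → u ⊑ w
⊑-trans {u = u} {v} {w} p q = ≼ᵛ⇒⊑ {u = u} {w} λ j →
  let a , b = ⊑⇒≼ᵛ {u = u} {v} p j ; c , e = ⊑⇒≼ᵛ {u = v} {w} q j in ℕP.≤-trans a c , ℕP.≤-trans b e

⊑-complement : {u v : ℤ^ n} → u ⊑ v → (v -ᵛ u) ⊑ v
⊑-complement {u = u} {v} p = ≼ᵛ⇒⊑ {u = v -ᵛ u} {v} λ j →
  let a , b = ≼-complement (lookup u j) (lookup v j) (⊑⇒≼ᵛ {u = u} {v} p j) in
  ≡.subst (_≼ lookup v j) (≡.sym (lookup--ᵛ v u j))
    (ℕP.m+n≤o⇒n≤o (pos (lookup u j)) (ℕP.≤-reflexive (≡.sym a)) , ℕP.m+n≤o⇒n≤o (neg (lookup u j)) (ℕP.≤-reflexive (≡.sym b)))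

sum-mono-≤ : ∀ {m} {f g : Fin m → ℕ} → (∀ i → f i ≤ℕ g i) → sum f ≤ℕ sum g
sum-mono-≤ {zero}  p = z≤n
sum-mono-≤ {suc m} p = ℕP.+-mono-≤ (p zero) (sum-mono-≤ (λ i → p (suc i)))

sum-mono-< : ∀ {m} {f g : Fin m → ℕ} → (∀ i → f i ≤ℕ g i) → ∀ k → f k < g k → sum f < sum g
sum-mono-< {suc m} p zero    q = ℕP.+-mono-<-≤ q (sum-mono-≤ (λ i → p (suc i)))
sum-mono-< {suc m} p (suc k) q = ℕP.+-mono-≤-< (p zero) (sum-mono-< (λ i → p (suc i)) k q)

‖_‖ : ℤ^ n → ℕ
‖ z ‖ = sum (λ j → ∣ lookup z j ∣)

∣lookup-+ᵛ∣ : (u v : ℤ^ n) → ∀ j → ∣ lookup (u +ᵛ v) j ∣ ≤ℕ ∣ lookup u j ∣ +ℕ ∣ lookup v j ∣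
∣lookup-+ᵛ∣ u v j rewrite lookup-+ᵛ u v j = ℤP.∣i+j∣≤∣i∣+∣j∣ (lookup u j) (lookup v j)

‖u+v‖≤‖u‖+‖v‖ : (u v : ℤ^ n) → ‖ u +ᵛ v ‖ ≤ℕ ‖ u ‖ +ℕ ‖ v ‖
‖u+v‖≤‖u‖+‖v‖ u v = ℕP.≤-trans (sum-mono-≤ (∣lookup-+ᵛ∣ u v))
  (ℕP.≤-reflexive (∑-distrib-+ (λ j → ∣ lookup u j ∣) (λ j → ∣ lookup v j ∣)))

‖u‖+‖v-u‖≡‖v‖ : {u v : ℤ^ n} → u ⊑ v → ‖ u ‖ +ℕ ‖ v -ᵛ u ‖ ≡ ‖ v ‖
‖u‖+‖v-u‖≡‖v‖ {u = u} {v} p = ≡.trans (≡.sym (∑-distrib-+ (λ j → ∣ lookup u j ∣) (λ j → ∣ lookup (v -ᵛ u) j ∣)))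
  (sum-cong-≗ coordinate)
  where
  coordinate : ∀ j → ∣ lookup u j ∣ +ℕ ∣ lookup (v -ᵛ u) j ∣ ≡ ∣ lookup v j ∣
  coordinate j rewrite lookup--ᵛ v u j = lemma (lookup u j) (lookup v j) (⊑⇒≼ᵛ {u = u} {v} p j)
    where
    lemma : ∀ i k → i ≼ k → ∣ i ∣ +ℕ ∣ k -ℤ i ∣ ≡ ∣ k ∣
    lemma i k q = begin
      ∣ i ∣ +ℕ ∣ k -ℤ i ∣                                          ≡⟨ ≡.cong₂ _+ℕ_ (∣i∣≡pos+neg i) (∣i∣≡pos+neg (k -ℤ i)) ⟩
      (pos i +ℕ neg i) +ℕ (pos (k -ℤ i) +ℕ neg (k -ℤ i))           ≡⟨ +ℕ-interchange (pos i) (neg i) (pos (k -ℤ i)) (neg (k -ℤ i)) ⟩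
      (pos i +ℕ pos (k -ℤ i)) +ℕ (neg i +ℕ neg (k -ℤ i))           ≡⟨ ≡.cong₂ _+ℕ_ (proj₁ (≼-complement i k q)) (proj₂ (≼-complement i k q)) ⟨
      pos k +ℕ neg k                                               ≡⟨ ∣i∣≡pos+neg k ⟨
      ∣ k ∣                                                        ∎
      where
      open ≡-Reasoning

‖z‖≡0⇒z≡0 : (z : ℤ^ n) → ‖ z ‖ ≡ 0 → z ≡ 0ᵛ
‖z‖≡0⇒z≡0 []      _  = ≡.refl
‖z‖≡0⇒z≡0 (x ∷ z) eq = ≡.cong₂ _∷_ (ℤP.∣i∣≡0⇒i≡0 (ℕP.m+n≡0⇒m≡0 ∣ x ∣ eq)) (‖z‖≡0⇒z≡0 z (ℕP.m+n≡0⇒n≡0 ∣ x ∣ eq))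

-- Cancellation in sums of integers

Conflict : ℤ → ℤ → Set
Conflict i j = ∣ i +ℤ j ∣ < ∣ i ∣ +ℕ ∣ j ∣

-- The positive form of `¬ Conflict i k`. With i fixed it is closed under addition in k, so it
-- passes from the single parts of a sum to the whole sum.
Aligned : ℤ → ℤ → Set
Aligned (+ zero)  k = ⊤
Aligned (+ suc _) k = 0ℤ ≤ℤ k
Aligned -[1+ _ ]  k = k ≤ℤ 0ℤ

Aligned-0 : ∀ i → Aligned i 0ℤ
Aligned-0 (+ zero)  = tt
Aligned-0 (+ suc _) = ℤP.≤-refl
Aligned-0 -[1+ _ ]  = ℤP.≤-refl

Aligned-+ : ∀ i {j k} → Aligned i j → Aligned i k → Aligned i (j +ℤ k)
Aligned-+ (+ zero)  p q = tt
Aligned-+ (+ suc _) p q = ℤP.+-mono-≤ p q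
Aligned-+ -[1+ _ ]  p q = ℤP.+-mono-≤ p q

¬Conflict⇒Aligned : ∀ i j → ¬ Conflict i j → Aligned i j
¬Conflict⇒Aligned (+ zero)  j         _  = tt
¬Conflict⇒Aligned (+ suc m) (+ n)     _  = +≤+ z≤n
¬Conflict⇒Aligned (+ suc m) -[1+ n ]  ¬c = contradiction (cancel m n) ¬c
  where
  cancel : ∀ m n → ∣ suc m ⊖ suc n ∣ < suc m +ℕ suc n
  cancel m n rewrite ℤP.[1+m]⊖[1+n]≡m⊖n m n = s≤s (ℕP.≤-trans (ℤP.∣m⊝n∣≤m⊔n m n)
    (ℕP.≤-trans (ℕP.m⊔n≤m+n m n) (ℕP.+-monoʳ-≤ m (ℕP.n≤1+n n))))
¬Conflict⇒Aligned -[1+ m ]  (+ zero)  _  = ℤP.≤-refl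
¬Conflict⇒Aligned -[1+ m ]  (+ suc n) ¬c = contradiction (cancel m n) ¬c
  where
  cancel : ∀ m n → ∣ suc n ⊖ suc m ∣ < suc m +ℕ suc n
  cancel m n rewrite ℤP.[1+m]⊖[1+n]≡m⊖n n m = s≤s (ℕP.≤-trans (ℤP.∣m⊝n∣≤m⊔n n m)
    (ℕP.≤-trans (ℕP.m⊔n≤m+n n m) (ℕP.≤-trans (ℕP.≤-reflexive (ℕP.+-comm n m)) (ℕP.+-monoʳ-≤ m (ℕP.n≤1+n n)))))
¬Conflict⇒Aligned -[1+ m ]  -[1+ n ]  _  = -≤+

Aligned⇒≼ : ∀ i k → Aligned i k → i ≼ (i +ℤ k)
Aligned⇒≼ (+ zero)  k         _ = z≤n , z≤n
Aligned⇒≼ (+ suc m) (+ n)     _ = ℕP.m≤m+n (suc m) n , z≤n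
Aligned⇒≼ -[1+ m ]  (+ zero)  _ = ℕP.≤-refl , ℕP.≤-refl
Aligned⇒≼ -[1+ m ]  (+ suc n) (+≤+ ())
Aligned⇒≼ -[1+ m ]  -[1+ n ]  _ = z≤n , s≤s (ℕP.m≤n⇒m≤1+n (ℕP.m≤m+n m n))

-- Finite bases of fibers

-- Vectors are functions compared pointwise; generation is therefore treated up to `_≈_` and not
-- `_≡_`.
ℕ^_ : ℕ → CommutativeMonoid 0ℓ 0ℓ
ℕ^ m = Pointwise.commutativeMonoid (Fin m) ℕP.+-0-commutativeMonoid

module _ where
  open FinitelyGenerated using (Gen; nil; cons; FG; Gen-∙; Gen-·; Gen-⊆; Gen-∈; Gen-resp)

  private
    shift : (Fin m → ℕ) → Fin (suc m) → ℕ
    shift x zero    = 0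
    shift x (suc i) = x i

    first : Fin (suc m) → ℕ
    first zero    = 1
    first (suc _) = 0

  Gen-shift : ∀ {R x} → Gen (ℕ^ m) R x → Gen (ℕ^ suc m) (List.map shift R) (shift x)
  Gen-shift (nil p)      = nil λ { zero → ≡.refl ; (suc i) → p i }
  Gen-shift (cons r g p) = cons (∈-map⁺ shift r) (Gen-shift g) λ { zero → ≡.refl ; (suc i) → p i }

  ℕ^-finitelyGenerated : ∀ m → FG (ℕ^ m) (λ _ → ⊤) (λ _ → ⊤)
  ℕ^-finitelyGenerated zero    = [] , [] , λ _ → nil λ ()
  ℕ^-finitelyGenerated (suc m) with ℕ^-finitelyGenerated m
  ... | R , _ , gen = first ∷ List.map shift R , All.universal (λ _ → tt) _ , λ {x} _ →
    Gen-resp (ℕ^ suc m) (decompose x)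
      (Gen-∙ (ℕ^ suc m) (Gen-· (ℕ^ suc m) (x zero) (Gen-∈ (ℕ^ suc m) (here ≡.refl)))
                        (Gen-⊆ (ℕ^ suc m) there (Gen-shift (gen {x ∘ suc} tt))))
    where
    open Mult (ℕ^ suc m) using () renaming (_×_ to _·_)
    multiple : ∀ a → (a · first {m}) zero ≡ a × (∀ i → (a · first {m}) (suc i) ≡ 0)
    multiple zero    = ≡.refl , λ _ → ≡.refl
    multiple (suc a) = ≡.cong suc (proj₁ (multiple a)) , proj₂ (multiple a)
    decompose : ∀ x i → x i ≡ (x zero · first) i +ℕ shift (x ∘ suc) i
    decompose x zero    = ≡.sym (≡.trans (ℕP.+-identityʳ _) (proj₁ (multiple (x zero))))
    decompose x (suc i) = ≡.cong (_+ℕ x (suc i)) (≡.sym (proj₂ (multiple (x zero)) i))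

-- The embedding of (ℤⁿ, ⊑) into (ℕ²ⁿ, ≤) by positive and negative parts.
coords : ℤ^ n → Fin (n +ℕ n) → ℕ
coords {n} z i = [ pos ∘ lookup z , neg ∘ lookup z ]′ (splitAt n i)

coords-↑ˡ : (z : ℤ^ n) → ∀ j → coords z (j ↑ˡ n) ≡ pos (lookup z j)
coords-↑ˡ {n} z j rewrite splitAt-↑ˡ n j n = ≡.refl

coords-↑ʳ : (z : ℤ^ n) → ∀ j → coords z (n ↑ʳ j) ≡ neg (lookup z j)
coords-↑ʳ {n} z j rewrite splitAt-↑ʳ n n j = ≡.refl

coords-mono⁻ : {u v : ℤ^ n} → (∀ i → coords u i ≤ℕ coords v i) → u ⊑ v
coords-mono⁻ {n} {u} {v} p = ≼ᵛ⇒⊑ {u = u} {v} λ j →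
  ≡.subst₂ _≤ℕ_ (coords-↑ˡ u j) (coords-↑ˡ v j) (p (j ↑ˡ n)) ,
  ≡.subst₂ _≤ℕ_ (coords-↑ʳ u j) (coords-↑ʳ v j) (p (n ↑ʳ j))

coords-mono : {u v : ℤ^ n} → u ⊑ v → ∀ i → coords u i ≤ℕ coords v i
coords-mono {n} {u} {v} p i with splitAt n i
... | inj₁ j = proj₁ (⊑⇒≼ᵛ {u = u} {v} p j)
... | inj₂ j = proj₂ (⊑⇒≼ᵛ {u = u} {v} p j)

-- A left inverse of `coords`. Unlike `coords` it is additive, so linear equations can be pulled
-- back along it to ℕ²ⁿ.
difference : (Fin (n +ℕ n) → ℕ) → ℤ^ n
difference {n} x = tabulate λ j → + x (j ↑ˡ n) -ℤ + x (n ↑ʳ j)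

lookup-difference : (x : Fin (n +ℕ n) → ℕ) → ∀ j → lookup (difference x) j ≡ + x (j ↑ˡ n) -ℤ + x (n ↑ʳ j)
lookup-difference x = lookup∘tabulate _

difference-+ : (x y : Fin (n +ℕ n) → ℕ) → difference (λ i → x i +ℕ y i) ≡ difference x +ᵛ difference y
difference-+ {n} x y = lookup-ext λ j → begin
  lookup (difference (λ i → x i +ℕ y i)) j                       ≡⟨ lookup-difference (λ i → x i +ℕ y i) j ⟩
  + (x (j ↑ˡ n) +ℕ y (j ↑ˡ n)) -ℤ + (x (n ↑ʳ j) +ℕ y (n ↑ʳ j))   ≡⟨ rearrange (+ x (j ↑ˡ n)) (+ y (j ↑ˡ n)) (+ x (n ↑ʳ j)) (+ y (n ↑ʳ j)) ⟩
  (+ x (j ↑ˡ n) -ℤ + x (n ↑ʳ j)) +ℤ (+ y (j ↑ˡ n) -ℤ + y (n ↑ʳ j)) ≡⟨ ≡.cong₂ _+ℤ_ (lookup-difference x j) (lookup-difference y j) ⟨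
  lookup (difference x) j +ℤ lookup (difference y) j             ≡⟨ lookup-+ᵛ (difference x) (difference y) j ⟨
  lookup (difference x +ᵛ difference y) j                        ∎
  where
  open ≡-Reasoning
  rearrange : ∀ a b p q → (a +ℤ b) -ℤ (p +ℤ q) ≡ (a -ℤ p) +ℤ (b -ℤ q)
  rearrange = solve-∀

difference-cong : {x y : Fin (n +ℕ n) → ℕ} → (∀ i → x i ≡ y i) → difference x ≡ difference y
difference-cong {n} {x} {y} eq = lookup-ext λ j → ≡.trans (lookup-difference x j)
  (≡.trans (≡.cong₂ (λ a b → + a -ℤ + b) (eq (j ↑ˡ n)) (eq (n ↑ʳ j))) (≡.sym (lookup-difference y j)))

difference-0 : difference {n} (λ _ → 0) ≡ 0ᵛ
difference-0 = lookup-ext λ j → ≡.trans (lookup-difference (λ _ → 0) j) (≡.sym (lookup-0ᵛ j))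

difference-coords : (z : ℤ^ n) → difference (coords z) ≡ z
difference-coords {n} z = lookup-ext λ j → ≡.trans (lookup-difference (coords z) j)
  (≡.trans (≡.cong₂ (λ a b → + a -ℤ + b) (coords-↑ˡ z j) (coords-↑ʳ z j)) (pos-neg (lookup z j)))
  where
  pos-neg : ∀ i → + pos i -ℤ + neg i ≡ i
  pos-neg (+ k)        = ℤP.+-identityʳ (+ k)
  pos-neg -[1+ k ]   = ≡.refl

difference-⊑ : (x : Fin (n +ℕ n) → ℕ) (z : ℤ^ n) → (∀ i → x i ≤ℕ coords z i) → difference x ⊑ z
difference-⊑ {n} x z p = ≼ᵛ⇒⊑ {u = difference x} {z} λ j → ≡.subst (_≼ lookup z j) (≡.sym (lookup-difference x j))
  (⊖-≼ _ _ (lookup z j) ≡.refl ≡.refl (x (j ↑ˡ n)) (x (n ↑ʳ j))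
    (≡.subst (x (j ↑ˡ n) ≤ℕ_) (coords-↑ˡ z j) (p (j ↑ˡ n)))
    (≡.subst (x (n ↑ʳ j) ≤ℕ_) (coords-↑ʳ z j) (p (n ↑ʳ j))))

module _ (A : Matrix d n) where

  record Basis (b : ℤ^ d) : Set where
    field
      elements : List (ℤ^ n)
      inFiber  : All (Fiber A b) elements
      below    : ∀ z → Fiber A b z → Any (_⊑ z) elements

  -- Az = b is homogenised to A(x⁺ − x⁻) = x₀ b with x ∈ ℕ¹⁺²ⁿ; a generator of these solutions
  -- that is used in a solution with x₀ = 1 and has itself x₀ = 1 lies below that solution.
  homogeneousBasis : ∀ b → Basis b
  homogeneousBasis b with ℕ^-finitelyGenerated (suc (n +ℕ n))
  ... | H , UH , gen = record
    { elements = List.map (difference ∘ (_∘ suc)) (List.filter (λ r → r zero ℕP.≟ 1) gens)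
    ; inFiber  = All.tabulate inFiber
    ; below    = below }
    where
    open FinitelyGenerated (ℕ^ suc (n +ℕ n)) hiding (module Row)
    open CommutativeMonoid (ℕ^ suc (n +ℕ n)) using (Carrier; _≈_; rawMonoid)
    open MonoidMorphisms rawMonoid ℤ.+-0-rawMonoid using (IsMonoidHomomorphism)
    φ : Fin d → Carrier → ℤ
    φ i x = dot (lookup A i) (difference (x ∘ suc)) -ℤ + x zero *ℤ lookup b i
    φ-hom : ∀ i → IsMonoidHomomorphism (φ i)
    φ-hom i = record
      { isMagmaHomomorphism = record
        { isRelHomomorphism = record { cong = λ {x} {y} eq → ≡.cong₂ (λ u t → dot (lookup A i) u -ℤ + t *ℤ lookup b i)
                                          (difference-cong (eq ∘ suc)) (eq zero) }
        ; homo = λ x y → ≡.trans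
            (≡.cong (_-ℤ + (x zero +ℕ y zero) *ℤ lookup b i)
              (≡.trans (≡.cong (dot (lookup A i)) (difference-+ (x ∘ suc) (y ∘ suc))) (dot-+ᵛ (lookup A i) _ _)))
            (rearrange (dot (lookup A i) (difference (x ∘ suc))) (dot (lookup A i) (difference (y ∘ suc))) (+ x zero) (+ y zero) (lookup b i)) }
      ; ε-homo = ≡.trans (≡.cong (λ u → dot (lookup A i) u -ℤ 0ℤ *ℤ lookup b i) difference-0) (≡.cong₂ (λ u v → u -ℤ v) (dot-0ᵛ (lookup A i)) (ℤP.*-zeroˡ (lookup b i))) }
      where
      rearrange : ∀ p q s t c → (p +ℤ q) -ℤ (s +ℤ t) *ℤ c ≡ (p -ℤ s *ℤ c) +ℤ (q -ℤ t *ℤ c)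
      rearrange = solve-∀
    ker = commonKernel (H , UH , gen) (record { ε∈ = tt ; ∙∈ = λ _ _ → tt }) φ φ-hom
    gens = proj₁ ker
    difference-fiber : ∀ {x} → x zero ≡ 1 → (∀ i → φ i x ≡ 0ℤ) → Fiber A b (difference (x ∘ suc))
    difference-fiber {x} x₀≡1 φx≡0 = lookup-ext λ i → begin
      lookup (A *ᵛ difference (x ∘ suc)) i     ≡⟨ lookup-map i (λ row → dot row (difference (x ∘ suc))) A ⟩
      dot (lookup A i) (difference (x ∘ suc))  ≡⟨ ℤP.i-j≡0⇒i≡j _ (1ℤ *ℤ lookup b i) (≡.trans (≡.cong (λ t → dot (lookup A i) (difference (x ∘ suc)) -ℤ + t *ℤ lookup b i) (≡.sym x₀≡1)) (φx≡0 i)) ⟩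
      1ℤ *ℤ lookup b i                         ≡⟨ ℤP.*-identityˡ _ ⟩
      lookup b i                               ∎
      where open ≡-Reasoning
    inFiber : ∀ {z} → z ∈ List.map (difference ∘ (_∘ suc)) (List.filter (λ r → r zero ℕP.≟ 1) gens) → Fiber A b z
    inFiber z∈ with ∈-map⁻ (difference ∘ (_∘ suc)) z∈
    ... | r , r∈ , ≡.refl with ∈-filter⁻ (λ r → r zero ℕP.≟ 1) {xs = gens} r∈
    ...   | r∈gens , r₀≡1 = difference-fiber {r} r₀≡1 (proj₂ (All.lookup (proj₁ (proj₂ ker)) r∈gens))
    unitPart : ∀ {x} → Gen gens x → x zero ≡ 1 → ∃[ r ] (r ∈ gens × r zero ≡ 1 × (∀ i → r i ≤ℕ x i))
    unitPart (nil p) x₀≡1 = contradiction (≡.trans (≡.sym x₀≡1) (p zero)) λ ()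
    unitPart {x} (cons {r = r} {y} r∈ g p) x₀≡1 with r zero in r₀
    ... | suc zero    = r , r∈ , r₀ , λ i → ≡.subst (r i ≤ℕ_) (≡.sym (p i)) (ℕP.m≤m+n (r i) (y i))
    ... | suc (suc k) = contradiction (≡.trans (≡.sym x₀≡1) (≡.trans (p zero) (≡.cong (_+ℕ y zero) r₀))) λ ()
    ... | zero with unitPart g (≡.trans (≡.sym (≡.trans (p zero) (≡.cong (_+ℕ y zero) r₀))) x₀≡1)
    ...   | s , s∈ , s₀ , s≤y = s , s∈ , s₀ , λ i →
      ≡.subst (s i ≤ℕ_) (≡.sym (p i)) (ℕP.≤-trans (s≤y i) (ℕP.m≤n+m (y i) (r i)))
    homogenise : ℤ^ n → Carrier
    homogenise z zero    = 1
    homogenise z (suc i) = coords z i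
    below : ∀ z → Fiber A b z → Any (_⊑ z) (List.map (difference ∘ (_∘ suc)) (List.filter (λ r → r zero ℕP.≟ 1) gens))
    below z Az≡b with unitPart (proj₂ (proj₂ ker) {homogenise z} (tt , solution)) ≡.refl
      where
      solution : ∀ i → φ i (homogenise z) ≡ 0ℤ
      solution i = begin
        dot (lookup A i) (difference (coords z)) -ℤ 1ℤ *ℤ lookup b i  ≡⟨ ≡.cong₂ (λ u c → dot (lookup A i) u -ℤ c) (difference-coords z) (ℤP.*-identityˡ (lookup b i)) ⟩
        dot (lookup A i) z -ℤ lookup b i                              ≡⟨ ≡.cong (_-ℤ lookup b i) (lookup-map i (λ row → dot row z) A) ⟨
        lookup (A *ᵛ z) i -ℤ lookup b i                               ≡⟨ ≡.cong (λ c → lookup c i -ℤ lookup b i) Az≡b ⟩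
        lookup b i -ℤ lookup b i                                      ≡⟨ ℤP.+-inverseʳ (lookup b i) ⟩
        0ℤ                                                            ∎
        where open ≡-Reasoning
    ... | r , r∈ , r₀ , r≤z = Any.map (λ { ≡.refl → difference-⊑ (r ∘ suc) z (r≤z ∘ suc) })
      (∈-map⁺ (difference ∘ (_∘ suc)) (∈-filter⁺ (λ r → r zero ℕP.≟ 1) r∈ r₀))

  -- Sealed, so that later goals see a basis only through its fields and never unfold its
  -- construction.
  abstract
    basis : ∀ b → Basis b
    basis = homogeneousBasis

  Covers : Rel (ℤ^ d) 0ℓ
  Covers g s = ∀ z → Fiber A s z → ∃[ z₁ ] (Fiber A g z₁ × z₁ ⊑ z)

  ReducibleBy⇒Covers : ∀ {s g} → ReducibleBy A s g → Covers g s
  ReducibleBy⇒Covers red z z∈ with red z z∈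
  ... | z₁ , z₂ , z₁∈ , z₂∈ , z₁⊑z , z₂⊑z , eq = z₁ , z₁∈ , z₁⊑z

  -- The second summand is forced to be z - z₁: linearity puts it over s - g, and z₁ ⊑ z puts it
  -- below z.
  Covers⇒ReducibleBy : ∀ {s g} → Covers g s → ReducibleBy A s g
  Covers⇒ReducibleBy cov z z∈ with cov z z∈
  ... | z₁ , z₁∈ , z₁⊑z = z₁ , z -ᵛ z₁ , z₁∈ , ≡.trans (*ᵛ-minus A z z₁) (≡.cong₂ _-ᵛ_ z∈ z₁∈) ,
    z₁⊑z , ⊑-complement {u = z₁} {z} z₁⊑z , ≡.sym (u+[v-u]≡v z₁ z)

infix 4 _⊑?_

_⊑?_ : (u v : ℤ^ n) → Dec (u ⊑ v)
u ⊑? v = FinP.all? λ j → (0ℤ ≤ℤ? lookup u j *ℤ lookup v j) ×-dec (∣ lookup u j ∣ ℕP.≤? ∣ lookup v j ∣)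

-- A box bounds the i-th coordinate strictly by k if its entry is just k, and not at all if it is
-- nothing; finite unions of boxes are the complements of finitely generated up-sets of ℕᵐ.
module _ {m : ℕ} where

  Box : Set
  Box = Fin m → Maybe ℕ

  data _<∞_ : ℕ → Maybe ℕ → Set where
    <nothing : ∀ {k} → k <∞ nothing
    <just    : ∀ {k l} → k < l → k <∞ just l

  _∈ᵇ_ : (Fin m → ℕ) → Box → Set
  x ∈ᵇ β = ∀ i → x i <∞ β i

  _⊆ᵇ_ : Rel Box 0ℓ
  β ⊆ᵇ γ = ∀ i → β i ≤∞ γ i

  <∞-≤∞-trans : ∀ {k β γ} → k <∞ β → β ≤∞ γ → k <∞ γ
  <∞-≤∞-trans _         ≤nothing   = <nothing
  <∞-≤∞-trans (<just p) (≤just q)  = <just (ℕP.<-≤-trans p q)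

  meet : Maybe ℕ → Maybe ℕ → Maybe ℕ
  meet nothing  k        = k
  meet (just k) nothing  = just k
  meet (just k) (just l) = just (k ⊓ l)

  meet⁺ : ∀ {x} k l → x <∞ k → x <∞ l → x <∞ meet k l
  meet⁺ nothing  l        p         q         = q
  meet⁺ (just k) nothing  p         q         = p
  meet⁺ (just k) (just l) (<just p) (<just q) = <just (ℕP.⊓-pres-m< p q)

  meet⁻ : ∀ {x} k l → x <∞ meet k l → x <∞ k × x <∞ l
  meet⁻ nothing  l        p         = <nothing , p
  meet⁻ (just k) nothing  p         = p , <nothing
  meet⁻ (just k) (just l) (<just p) = <just (ℕP.m<n⊓o⇒m<n k l p) , <just (ℕP.m<n⊓o⇒m<o k l p)

  halfSpace : Fin m → ℕ → Box
  halfSpace i k j with i FinP.≟ j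
  ... | yes _ = just k
  ... | no _  = nothing

  halfSpace⁺ : ∀ {x : Fin m → ℕ} {i k} → x i < k → x ∈ᵇ halfSpace i k
  halfSpace⁺ {i = i} p j with i FinP.≟ j
  ... | yes ≡.refl = <just p
  ... | no _       = <nothing

  halfSpace⁻ : ∀ {x : Fin m → ℕ} i k → x ∈ᵇ halfSpace i k → x i < k
  halfSpace⁻ i k p with p i
  ... | q with i FinP.≟ i
  halfSpace⁻ i k p | <just q | yes _ = q
  halfSpace⁻ i k p | q       | no i≢i = contradiction ≡.refl i≢i

  -- By De Morgan, x avoids the cone above u iff `x i < u i` for some i. Avoiding all cones means
  -- choosing one such i per u, and each choice contributes one meet of half-spaces.
  outside : List (Fin m → ℕ) → List Box
  outside []       = (λ _ → nothing) ∷ []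
  outside (u ∷ us) = cartesianProductWith (λ β γ i → meet (β i) (γ i))
                       (List.map (λ i → halfSpace i (u i)) (allFin m)) (outside us)

  outside⁺ : ∀ us x → Any (λ u → ∀ i → u i ≤ℕ x i) us ⊎ ∃[ β ] (β ∈ outside us × x ∈ᵇ β)
  outside⁺ []       x = inj₂ (_ , here ≡.refl , λ _ → <nothing)
  outside⁺ (u ∷ us) x with outside⁺ us x | FinP.all? (λ i → u i ℕP.≤? x i)
  ... | inj₁ p           | _     = inj₁ (there p)
  ... | inj₂ _           | yes p = inj₁ (here p)
  ... | inj₂ (γ , γ∈ , xγ) | no ¬p with FinP.¬∀⟶∃¬ m (λ i → u i ≤ℕ x i) (λ i → u i ℕP.≤? x i) ¬p
  ...   | i , u≰x = inj₂ (_ , ∈-cartesianProductWith⁺ _ (∈-map⁺ _ (∈-allFin i)) γ∈ ,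
    λ j → meet⁺ (halfSpace i (u i) j) (γ j) (halfSpace⁺ {x = x} (ℕP.≰⇒> u≰x) j) (xγ j))

  outside⁻ : ∀ us {x β} → β ∈ outside us → x ∈ᵇ β → ¬ Any (λ u → ∀ i → u i ≤ℕ x i) us
  outside⁻ (u ∷ us) {x} β∈ xβ u≤x with ∈-cartesianProductWith⁻ _ (List.map (λ i → halfSpace i (u i)) (allFin m)) (outside us) β∈
  ... | η , γ , η∈ , γ∈ , ≡.refl with ∈-map⁻ _ η∈
  ...   | i , _ , ≡.refl with u≤x
  ...     | here p  = ℕP.<⇒≱ (halfSpace⁻ {x} i (u i) (λ j → proj₁ (meet⁻ (halfSpace i (u i) j) (γ j) (xβ j)))) (p i)
  ...     | there p = outside⁻ us γ∈ (λ j → proj₂ (meet⁻ (halfSpace i (u i) j) (γ j) (xβ j))) p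

-- Deciding reducibility, and its almost-fullness

module _ (A : Matrix d n) where

  covers? : ∀ g s → Dec (Covers A g s)
  covers? g s = map′ everywhere restrict
    (All.all? (λ z → Any.any? (_⊑? z) (elements (basis A g))) (elements (basis A s)))
    where
    open Basis
    restrict : Covers A g s → All (λ z → Any (_⊑ z) (elements (basis A g))) (elements (basis A s))
    restrict cov = All.map (λ {z} z∈ → let z₁ , z₁∈ , z₁⊑z = cov z z∈ in
      Any.map (λ {w} w⊑z₁ → ⊑-trans {u = w} {z₁} {z} w⊑z₁ z₁⊑z) (below (basis A g) z₁ z₁∈)) (inFiber (basis A s))
    everywhere : All (λ z → Any (_⊑ z) (elements (basis A g))) (elements (basis A s)) → Covers A g s
    everywhere all z z∈ with find (below (basis A s) z z∈)
    ... | w , w∈ , w⊑z with find (All.lookup all w∈)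
    ...   | v , v∈ , v⊑w = v , All.lookup (inFiber (basis A g)) v∈ , ⊑-trans {u = v} {w} {z} v⊑w w⊑z

  gaps : ℤ^ d → List (Box {n +ℕ n})
  gaps b = outside (List.map coords (Basis.elements (basis A b)))

  -- If z were above no basis point of g, it would lie in a gap of g, hence in a gap of s, and so
  -- above no basis point of s, although it is in the fiber of s.
  gaps⇒Covers : ∀ {g s} → Hoare _⊆ᵇ_ (gaps g) (gaps s) → Covers A g s
  gaps⇒Covers {g} {s} h z z∈ with outside⁺ (List.map coords (elements (basis A g))) (coords z)
    where open Basis
  ... | inj₁ p = let u , u∈ , u≤z = find p
                     v , v∈ , u≡  = ∈-map⁻ coords u∈ in
    v , All.lookup (Basis.inFiber (basis A g)) v∈ ,
    coords-mono⁻ {u = v} {z} (λ i → ≡.subst (λ u → u i ≤ℕ coords z i) u≡ (u≤z i))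
  ... | inj₂ (β , β∈ , zβ) = let γ , γ∈ , β⊆γ = find (All.lookup h β∈)
                                 w , w∈ , w⊑z = find (Basis.below (basis A s) z z∈) in
    contradiction (Any.map (λ { ≡.refl → coords-mono {u = w} {z} w⊑z }) (∈-map⁺ coords w∈))
      (outside⁻ (List.map coords (Basis.elements (basis A s))) {coords z} γ∈ (λ i → <∞-≤∞-trans (zβ i) (β⊆γ i)))

  AF-Covers : AF (Covers A)
  AF-Covers = AF-mono gaps⇒Covers (AF-on gaps (AF-Hoare (AF-pointwise AF-≤∞ (n +ℕ n))))

-- The completion algorithm

-ᵛ-0ᵛ : ∀ n → -ᵛ 0ᵛ {n} ≡ 0ᵛ
-ᵛ-0ᵛ zero    = ≡.refl
-ᵛ-0ᵛ (suc n) = ≡.cong (0ℤ ∷_) (-ᵛ-0ᵛ n)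

-- ℤⁿ is generated as a monoid by the vectors ±eᵢ, whose images are the input of the algorithm.
ℤ^-induction : ∀ n (P : ℤ^ n → Set) → P 0ᵛ → (∀ u v → P u → P v → P (u +ᵛ v)) →
  (∀ i → P (unit i)) → (∀ i → P (-ᵛ unit i)) → ∀ z → P z
ℤ^-induction zero    P p0 p+ pe p-e [] = p0
ℤ^-induction (suc n) P p0 p+ pe p-e (x ∷ z) = ≡.subst P (≡.cong₂ _∷_ (ℤP.+-identityʳ x) (+ᵛ-identityˡ z))
  (p+ (x ∷ 0ᵛ) (0ℤ ∷ z) (axis x)
    (ℤ^-induction n (P ∘ (0ℤ ∷_)) p0 (λ u v → p+ (0ℤ ∷ u) (0ℤ ∷ v)) (pe ∘ suc) (p-e ∘ suc) z))
  where
  -e : P (-[1+ 0 ] ∷ 0ᵛ)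
  -e = ≡.subst (λ v → P (-[1+ 0 ] ∷ v)) (-ᵛ-0ᵛ n) (p-e zero)
  axis : ∀ x → P (x ∷ 0ᵛ)
  axis (+ zero)     = p0
  axis (+ suc m)    = ≡.subst (λ v → P (+ suc m ∷ v)) (+ᵛ-identityˡ 0ᵛ) (p+ (1ℤ ∷ 0ᵛ) (+ m ∷ 0ᵛ) (pe zero) (axis (+ m)))
  axis -[1+ zero  ] = -e
  axis -[1+ suc m ] = ≡.subst (λ v → P (-[1+ suc m ] ∷ v)) (+ᵛ-identityˡ 0ᵛ) (p+ (-[1+ 0 ] ∷ 0ᵛ) (-[1+ m ] ∷ 0ᵛ) -e (axis -[1+ m ]))

⊑-refl : (u : ℤ^ n) → u ⊑ u
⊑-refl u = ≼ᵛ⇒⊑ {u = u} {u} λ j → ℕP.≤-refl , ℕP.≤-refl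

module _ (A : Matrix d n) where

  -- Outside the image the fiber is empty and every g reduces s vacuously, so with nonempty G
  -- normalisation could run forever. Termination therefore carries along that all vectors treated
  -- lie in the image.
  Image : ℤ^ d → Set
  Image b = ∃[ z ] Fiber A b z

  Image-+ : ∀ {b c} → Image b → Image c → Image (b +ᵛ c)
  Image-+ (u , p) (v , q) = u +ᵛ v , ≡.trans (*ᵛ-+ᵛ A u v) (≡.cong₂ _+ᵛ_ p q)

  ∈-generators⁻ : ∀ {f} → f ∈ generators A → Image f × f ≢ 0ᵛ
  ∈-generators⁻ f∈ with ∈-filter⁻ (λ t → ¬? (t ≟ᵛ 0ᵛ)) f∈
  ... | f∈± , f≢0 = [ column , negative ] (∈-++⁻ (map (λ i → A *ᵛ unit i) (allFin n)) f∈±) , f≢0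
    where
    column : ∀ {f} → f ∈ map (λ i → A *ᵛ unit i) (allFin n) → Image f
    column f∈ with ∈-map⁻ _ f∈
    ... | i , _ , ≡.refl = unit i , ≡.refl
    negative : ∀ {f} → f ∈ map -ᵛ_ (map (λ i → A *ᵛ unit i) (allFin n)) → Image f
    negative f∈ with ∈-map⁻ _ f∈
    ... | g , g∈ , ≡.refl with column g∈
    ...   | z , ≡.refl = -ᵛ z , *ᵛ--ᵛ A z

  column∈generators : ∀ i → A *ᵛ unit i ≢ 0ᵛ → A *ᵛ unit i ∈ generators A
  column∈generators i = ∈-filter⁺ (λ t → ¬? (t ≟ᵛ 0ᵛ)) (∈-++⁺ˡ (∈-map⁺ _ (∈-allFin i)))

  -column∈generators : ∀ i → A *ᵛ (-ᵛ unit i) ≢ 0ᵛ → A *ᵛ (-ᵛ unit i) ∈ generators A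
  -column∈generators i ≢0 = ∈-filter⁺ (λ t → ¬? (t ≟ᵛ 0ᵛ))
    (∈-++⁺ʳ columns (≡.subst (_∈ map -ᵛ_ columns) (≡.sym (*ᵛ--ᵛ A (unit i)))
      (∈-map⁺ -ᵛ_ (∈-map⁺ (λ i → A *ᵛ unit i) (∈-allFin i))))) ≢0
    where columns = map (λ i → A *ᵛ unit i) (allFin n)

  -- Termination

  _◁_ : FinSet d → FinSet d → Set
  G′ ◁ G = ∃[ f ] (G′ ≡ f ∷ G × Irreducible A G f)

  irreducible⇒¬Covers : ∀ {G f} → Irreducible A G f → ¬ Any (λ g → Covers A g f) G
  irreducible⇒¬Covers irr p = let g , g∈ , cov = find p in irr (g , g∈ , Covers⇒ReducibleBy A cov)

  -- T is what is left of an almost full relation after the members of G have been seen. It may hold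
  -- at y only because some g in G covers y; this excuse is void when y is irreducible, so new
  -- members form a bad sequence.
  ◁-accessible : ∀ {T G} → AF T → (∀ {y z} → T y z → Covers A y z ⊎ Any (λ g → Covers A g y) G) → Acc _◁_ G
  ◁-accessible (total t) inv = acc λ { (f , ≡.refl , irr) → acc λ { (f′ , ≡.refl , irr′) →
    [ (λ cov → contradiction (here cov) (irreducible⇒¬Covers irr′))
    , (λ cov → contradiction cov (irreducible⇒¬Covers irr)) ] (inv (t f f′)) } }
  ◁-accessible (later t) inv = acc λ { (f , ≡.refl , irr) → ◁-accessible (t f)
    [ [ inj₁ , inj₂ ∘ there ]′ ∘ inv
    , [ inj₂ ∘ here , (λ cov → contradiction cov (irreducible⇒¬Covers irr)) ]′ ∘ inv ]′ }

  Terminates : Config d → Set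
  Terminates = Acc (flip (Step A))

  -- Every reduction splits a nonzero part off a fixed witness z of s.
  normalising-terminates : ∀ {G C s} → (∀ {g} → g ∈ G → g ≢ 0ᵛ) → Terminates (loop G C) →
    (∀ {f} → Irreducible A G f → f ≢ 0ᵛ → Image f → Terminates (loop (f ∷ G) (C ++ map (f +ᵛ_) (f ∷ G)))) →
    ∀ z → Fiber A s z → Acc _<_ ‖ z ‖ → Terminates (normalising s G C)
  normalising-terminates {G} {C} {s} G≢0 discarded extended z z∈ (acc rec) = acc λ
    { (reduce g∈ red) → let z₁ , z₁∈ , z₁⊑z = ReducibleBy⇒Covers A red z z∈ in
        normalising-terminates G≢0 discarded extended (z -ᵛ z₁)
          (≡.trans (*ᵛ-minus A z z₁) (≡.cong₂ _-ᵛ_ z∈ z₁∈))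
          -- z₁ lies over g ≠ 0 and is therefore nonzero, while norms add along z₁ ⊑ z. This is
          -- where it matters that 0 joins G only at the exit.
          (rec (≡.subst (‖ z -ᵛ z₁ ‖ <_) (‖u‖+‖v-u‖≡‖v‖ {u = z₁} {z} z₁⊑z)
            (ℕP.m<n+m _ (ℕP.n≢0⇒n>0 λ ‖z₁‖≡0 → G≢0 g∈
              (≡.trans (≡.sym z₁∈) (≡.trans (≡.cong (A *ᵛ_) (‖z‖≡0⇒z≡0 z₁ ‖z₁‖≡0)) (*ᵛ-0ᵛ A)))))))
    ; (discard _ _) → discarded
    ; (extend irr f≢0) → extended irr f≢0 (z , z∈) }

  sums-Image : ∀ {f H} → Image f → (∀ {g} → g ∈ H → Image g) → ∀ {t} → t ∈ map (f +ᵛ_) H → Image t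
  sums-Image f-im H-im t∈ with ∈-map⁻ _ t∈
  ... | g , g∈ , ≡.refl = Image-+ f-im (H-im g∈)

  ∖-⊆ : ∀ {C : FinSet d} {s} → C ∖ s ⊆ˡ C
  ∖-⊆ {s = s} t∈ = proj₁ (∈-filter⁻ (λ t → ¬? (t ≟ᵛ s)) t∈)

  ∖-shorter : ∀ {C : FinSet d} {s} → s ∈ C → length (C ∖ s) < length C
  ∖-shorter {C} {s} s∈ = filter-notAll (λ t → ¬? (t ≟ᵛ s)) C (lose s∈ λ s≢s → s≢s ≡.refl)

  -- A lexicographic descent: C grows only when G is extended, which `_◁_` bounds; otherwise a round
  -- that returns to the loop shortens C.
  loop-terminates : ∀ {G} → Acc _◁_ G → (∀ {g} → g ∈ G → Image g × g ≢ 0ᵛ) →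
    ∀ {C} → (∀ {s} → s ∈ C → Image s) → Terminates (loop G C)
  loop-terminates {G} (acc recG) G-ok C-ok = shrink (<-wellFounded _) C-ok
    where
    ∷-ok : ∀ {f} → Image f → f ≢ 0ᵛ → ∀ {g} → g ∈ f ∷ G → Image g × g ≢ 0ᵛ
    ∷-ok f-im f≢0 (here ≡.refl) = f-im , f≢0
    ∷-ok f-im f≢0 (there g∈)    = G-ok g∈
    shrink : ∀ {C} → Acc _<_ (length C) → (∀ {s} → s ∈ C → Image s) → Terminates (loop G C)
    shrink {C} (acc recC) C-ok = acc λ
      { (choose {s = s} s∈C) → normalising-terminates (proj₂ ∘ G-ok)
          (shrink (recC (∖-shorter s∈C)) (C-ok ∘ ∖-⊆ {C}))
          (λ {f} irr f≢0 f-im → loop-terminates (recG (f , ≡.refl , irr)) (∷-ok f-im f≢0)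
            ([ C-ok ∘ ∖-⊆ {C} , sums-Image f-im (proj₁ ∘ ∷-ok f-im f≢0) ] ∘ ∈-++⁻ (C ∖ s)))
          (proj₁ (C-ok s∈C)) (proj₂ (C-ok s∈C)) (<-wellFounded _)
      ; exit → acc λ () }

  start-terminates : Terminates (start A)
  start-terminates = loop-terminates (◁-accessible (AF-Covers A) inj₁) ∈-generators⁻ sums
    where
    sums : ∀ {s} → s ∈ List.cartesianProductWith _+ᵛ_ (generators A) (generators A) → Image s
    sums s∈ with ∈-cartesianProductWith⁻ _+ᵛ_ (generators A) (generators A) s∈
    ... | f , g , f∈ , g∈ , ≡.refl = Image-+ (proj₁ (∈-generators⁻ f∈)) (proj₁ (∈-generators⁻ g∈))

  -- Only the normal form procedure could get stuck; `covers?` decides whether a reducing g exists.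
  progress : ∀ c → (∃[ c′ ] Step A c c′) ⊎ (∃[ G ] c ≡ returned G)
  progress (loop G [])      = inj₁ (_ , exit)
  progress (loop G (s ∷ C)) = inj₁ (_ , choose (here ≡.refl))
  progress (returned G)     = inj₂ (G , ≡.refl)
  progress (normalising s G C) with Any.any? (λ g → covers? A g s) G | s ≟ᵛ 0ᵛ
  ... | yes p | _ = let g , g∈ , cov = find p in inj₁ (_ , reduce g∈ (Covers⇒ReducibleBy A cov))
  ... | no ¬p | yes s≡0 = inj₁ (_ , discard (λ { (g , g∈ , red) → ¬p (lose g∈ (ReducibleBy⇒Covers A red)) }) s≡0)
  ... | no ¬p | no s≢0  = inj₁ (_ , extend (λ { (g , g∈ , red) → ¬p (lose g∈ (ReducibleBy⇒Covers A red)) }) s≢0)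

  -- The loop invariant

  data ReducesToZero (G : FinSet d) : ℤ^ d → Set where
    done : ∀ {s} → s ≡ 0ᵛ → ReducesToZero G s
    step : ∀ {s g} → g ∈ G → Covers A g s → ReducesToZero G (s -ᵛ g) → ReducesToZero G s

  ReducesToZero-mono : ∀ {G G′ s} → G ⊆ˡ G′ → ReducesToZero G s → ReducesToZero G′ s
  ReducesToZero-mono G⊆G′ (done p)       = done p
  ReducesToZero-mono G⊆G′ (step g∈ c r)  = step (G⊆G′ g∈) c (ReducesToZero-mono G⊆G′ r)

  -- `Open` collects the sums still to be treated: members of C in the loop, also the vector under
  -- normalisation inside its body, and none after the exit.
  record Closed (G : FinSet d) (Open : ℤ^ d → Set) : Set where
    field
      generators⊆ : generators A ⊆ˡ G
      nonzero     : ∀ {g} → g ∈ G → g ≢ 0ᵛ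
      sums        : ∀ {f g} → f ∈ G → g ∈ G → Open (f +ᵛ g) ⊎ ReducesToZero G (f +ᵛ g)

  Invariant : Config d → Set
  Invariant (loop G C)          = Closed G (_∈ C)
  -- s₀ is the vector that the normal form procedure started from.
  Invariant (normalising s G C) = ∃[ s₀ ] (Closed G (λ t → t ∈ C ⊎ t ≡ s₀) ×
    (∀ {G′} → G ⊆ˡ G′ → ReducesToZero G′ s → ReducesToZero G′ s₀))
  Invariant (returned G)        = ∃[ G′ ] (G ≡ 0ᵛ ∷ G′ × Closed G′ (λ _ → ⊥))

  invariant-start : Invariant (start A)
  invariant-start = record
    { generators⊆ = id
    ; nonzero     = proj₂ ∘ ∈-generators⁻
    ; sums        = λ f∈ g∈ → inj₁ (∈-cartesianProductWith⁺ _+ᵛ_ f∈ g∈) }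

  invariant-step : ∀ {c c′} → Step A c c′ → Invariant c → Invariant c′
  invariant-step (choose {s = s} _) inv = s , record
    { generators⊆ = generators⊆ ; nonzero = nonzero
    ; sums = λ f∈ g∈ → [ inj₁ ∘ remove , inj₂ ] (sums f∈ g∈) } , λ _ → id
    where
    open Closed inv
    remove : ∀ {t C} → t ∈ C → t ∈ C ∖ s ⊎ t ≡ s
    remove {t} t∈ with t ≟ᵛ s
    ... | yes t≡s = inj₂ t≡s
    ... | no t≢s  = inj₁ (∈-filter⁺ (λ t → ¬? (t ≟ᵛ s)) t∈ t≢s)
  invariant-step (reduce g∈ red) (s₀ , closed , k) = s₀ , closed ,
    λ G⊆G′ r → k G⊆G′ (step (G⊆G′ g∈) (ReducibleBy⇒Covers A red) r)
  invariant-step (discard _ f≡0) (s₀ , closed , k) = record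
    { generators⊆ = generators⊆ ; nonzero = nonzero
    ; sums = λ f∈ g∈ → [ [ inj₁ , (λ eq → inj₂ (≡.subst (ReducesToZero _) (≡.sym eq) (k id (done f≡0)))) ] , inj₂ ] (sums f∈ g∈) }
    where open Closed closed
  invariant-step (extend {G} {C} {f} _ f≢0) (s₀ , closed , k) = record
    { generators⊆ = there ∘ generators⊆
    ; nonzero     = λ { (here ≡.refl) → f≢0 ; (there g∈) → nonzero g∈ }
    ; sums        = sums′ }
    where
    open Closed closed
    s₀-reduces : ReducesToZero (f ∷ G) s₀
    -- f covers itself and f - f = 0, so the path from s₀ to f continues to 0 once f has been added.
    -- For this case k is stated for every larger G′.
    s₀-reduces = k there (step (here ≡.refl) (λ z z∈ → z , z∈ , ⊑-refl z) (done (u-u≡0 f)))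
    sums′ : ∀ {g h} → g ∈ f ∷ G → h ∈ f ∷ G →
      (g +ᵛ h ∈ C ++ map (f +ᵛ_) (f ∷ G)) ⊎ ReducesToZero (f ∷ G) (g +ᵛ h)
    sums′ (here ≡.refl) h∈ = inj₁ (∈-++⁺ʳ C (∈-map⁺ (f +ᵛ_) h∈))
    sums′ {g} g∈@(there _) (here ≡.refl) =
      inj₁ (∈-++⁺ʳ C (≡.subst (_∈ map (f +ᵛ_) (f ∷ G)) (+ᵛ-comm f g) (∈-map⁺ (f +ᵛ_) g∈)))
    sums′ (there g∈) (there h∈) = [ [ inj₁ ∘ ∈-++⁺ˡ , (λ eq → inj₂ (≡.subst (ReducesToZero (f ∷ G)) (≡.sym eq) s₀-reduces)) ]
                                  , inj₂ ∘ ReducesToZero-mono there ] (sums g∈ h∈)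
  invariant-step (exit {G}) closed = G , ≡.refl , record
    { generators⊆ = generators⊆ ; nonzero = nonzero ; sums = λ f∈ g∈ → [ (λ ()) , inj₂ ] (sums f∈ g∈) }
    where open Closed closed

  invariant : ∀ {c c′} → Star (Step A) c c′ → Invariant c → Invariant c′
  invariant Star.ε          inv = inv
  invariant (s Star.◅ ss)   inv = invariant ss (invariant-step s inv)

  -- Descent on simultaneous decompositions

  module Descent {G : FinSet d} (gens⊆ : generators A ⊆ˡ G)
                 (reduces : ∀ {f g} → f ∈ G → g ∈ G → ReducesToZero G (f +ᵛ g)) (N : ℕ) where

    Family : Set
    Family = Fin N → ℤ^ n

    ∣∣_∣∣ : Family → ℕ
    ∣∣ Z ∣∣ = sum λ k → ‖ Z k ‖

    _Over_ : Family → ℤ^ d → Set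
    Z Over g = ∀ k → Fiber A g (Z k)

    _+ᶠ_ : Family → Family → Family
    (Y +ᶠ Z) k = Y k +ᵛ Z k

    ∣∣+ᶠ∣∣ : ∀ Y Z → ∣∣ Y +ᶠ Z ∣∣ ≤ℕ ∣∣ Y ∣∣ +ℕ ∣∣ Z ∣∣
    ∣∣+ᶠ∣∣ Y Z = ℕP.≤-trans (sum-mono-≤ λ k → ‖u+v‖≤‖u‖+‖v‖ (Y k) (Z k))
      (ℕP.≤-reflexive (∑-distrib-+ (λ k → ‖ Y k ‖) (λ k → ‖ Z k ‖)))

    Clash : Family → Family → Set
    Clash Y Z = ∃[ k ] ∃[ j ] Conflict (lookup (Y k) j) (lookup (Z k) j)

    clash? : ∀ Y Z → Dec (Clash Y Z)
    clash? Y Z = FinP.any? λ k → FinP.any? λ j → _ ℕP.<? _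

    Clash⇒∣∣+ᶠ∣∣< : ∀ Y Z → Clash Y Z → ∣∣ Y +ᶠ Z ∣∣ < ∣∣ Y ∣∣ +ℕ ∣∣ Z ∣∣
    Clash⇒∣∣+ᶠ∣∣< Y Z (k , j , c) = ℕP.<-≤-trans
      (sum-mono-< (λ k → ‖u+v‖≤‖u‖+‖v‖ (Y k) (Z k)) k (ℕP.<-≤-trans
        (sum-mono-< (∣lookup-+ᵛ∣ (Y k) (Z k)) j
          (≡.subst (λ i → ∣ i ∣ < ∣ lookup (Y k) j ∣ +ℕ ∣ lookup (Z k) j ∣) (≡.sym (lookup-+ᵛ (Y k) (Z k) j)) c))
        (ℕP.≤-reflexive (∑-distrib-+ (λ j → ∣ lookup (Y k) j ∣) (λ j → ∣ lookup (Z k) j ∣)))))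
      (ℕP.≤-reflexive (∑-distrib-+ (λ k → ‖ Y k ‖) (λ k → ‖ Z k ‖)))

    record Part : Set where
      constructor part
      field
        {vector} : ℤ^ d
        vector∈  : vector ∈ G
        family   : Family
        over     : family Over vector
    open Part

    sumOf : List Part → Family
    sumOf []      = λ _ → 0ᵛ
    sumOf (p ∷ L) = family p +ᶠ sumOf L

    cost : List Part → ℕ
    cost []      = 0
    cost (p ∷ L) = ∣∣ family p ∣∣ +ℕ cost L

    sumOf-++ : ∀ L M k → sumOf (L ++ M) k ≡ sumOf L k +ᵛ sumOf M k
    sumOf-++ []      M k = ≡.sym (+ᵛ-identityˡ _)
    sumOf-++ (p ∷ L) M k = ≡.trans (≡.cong (family p k +ᵛ_) (sumOf-++ L M k)) (≡.sym (+ᵛ-assoc _ _ _))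

    cost-++ : ∀ L M → cost (L ++ M) ≡ cost L +ℕ cost M
    cost-++ []      M = ≡.refl
    cost-++ (p ∷ L) M = ≡.trans (≡.cong (∣∣ family p ∣∣ +ℕ_) (cost-++ L M)) (≡.sym (ℕP.+-assoc ∣∣ family p ∣∣ _ _))

    -- A reduction ends in the fiber of 0, whose points are arbitrary kernel vectors and not just
    -- the zero vector; `remainder` keeps them.
    record Decomposition (Z : Family) : Set where
      constructor decomposition
      field
        parts     : List Part
        remainder : Family
        kernel    : remainder Over 0ᵛ
        sums      : ∀ k → sumOf parts k +ᵛ remainder k ≡ Z k

      size : ℕ
      size = cost parts +ℕ ∣∣ remainder ∣∣
    open Decomposition

    -- Every step of the reduction splits off a family that is ⊑ the current one, so nothing cancels
    -- and the norms of the pieces add up to that of Z.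
    decompose : ∀ {s} → ReducesToZero G s → ∀ Z → Z Over s → ∃[ D ] size {Z} D ≤ℕ ∣∣ Z ∣∣
    decompose (done ≡.refl) Z over-s = decomposition [] Z over-s (λ k → +ᵛ-identityˡ (Z k)) , ℕP.≤-refl
    decompose {s} (step {g = g} g∈ cov r) Z over-s with decompose r Z₂ Z₂-over
      where
      Z₁ Z₂ : Family
      Z₁ k = proj₁ (cov (Z k) (over-s k))
      Z₂ k = Z k -ᵛ Z₁ k
      Z₂-over : Z₂ Over (s -ᵛ g)
      Z₂-over k = ≡.trans (*ᵛ-minus A (Z k) (Z₁ k)) (≡.cong₂ _-ᵛ_ (over-s k) (proj₁ (proj₂ (cov (Z k) (over-s k)))))
    ... | D , size≤ = decomposition (part g∈ Z₁ (λ k → proj₁ (proj₂ (cov (Z k) (over-s k)))) ∷ parts D) (remainder D) (kernel D)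
            (λ k → ≡.trans (+ᵛ-assoc _ _ _) (≡.trans (≡.cong (Z₁ k +ᵛ_) (sums D k)) (u+[v-u]≡v (Z₁ k) (Z k)))) ,
        (begin
          (∣∣ Z₁ ∣∣ +ℕ cost (parts D)) +ℕ ∣∣ remainder D ∣∣  ≡⟨ ℕP.+-assoc ∣∣ Z₁ ∣∣ _ _ ⟩
          ∣∣ Z₁ ∣∣ +ℕ size D                                ≤⟨ ℕP.+-monoʳ-≤ ∣∣ Z₁ ∣∣ size≤ ⟩
          ∣∣ Z₁ ∣∣ +ℕ ∣∣ Z₂ ∣∣                              ≡⟨ ∑-distrib-+ (λ k → ‖ Z₁ k ‖) (λ k → ‖ Z₂ k ‖) ⟨
          sum (λ k → ‖ Z₁ k ‖ +ℕ ‖ Z₂ k ‖)                  ≡⟨ sum-cong-≗ (λ k → ‖u‖+‖v-u‖≡‖v‖ {u = Z₁ k} {Z k} (proj₂ (proj₂ (cov (Z k) (over-s k))))) ⟩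
          ∣∣ Z ∣∣                                           ∎)
      where
      open ℕP.≤-Reasoning
      Z₁ Z₂ : Family
      Z₁ k = proj₁ (cov (Z k) (over-s k))
      Z₂ k = Z k -ᵛ Z₁ k

    record Clashing (Y : Family) (L : List Part) : Set where
      field
        clashing : Part
        others   : List Part
        clash    : Clash Y (family clashing)
        sumOf≡   : ∀ k → sumOf L k ≡ family clashing k +ᵛ sumOf others k
        cost≡    : cost L ≡ ∣∣ family clashing ∣∣ +ℕ cost others

    -- Alignment is additive: a Y that clashes with no single part is aligned with their sum. A
    -- failure can thus be blamed on one part, which is moved to the front.
    findClash : ∀ Y L → (∀ k j → Aligned (lookup (Y k) j) (lookup (sumOf L k) j)) ⊎ Clashing Y L
    findClash Y [] = inj₁ λ k j → ≡.subst (Aligned (lookup (Y k) j)) (≡.sym (lookup-0ᵛ j)) (Aligned-0 (lookup (Y k) j))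
    findClash Y (p ∷ L) with clash? Y (family p) | findClash Y L
    ... | yes c | _ = inj₂ record { clashing = p ; others = L ; clash = c ; sumOf≡ = λ _ → ≡.refl ; cost≡ = ≡.refl }
    ... | no ¬c | inj₁ aligned = inj₁ λ k j →
      ≡.subst (Aligned (lookup (Y k) j)) (≡.sym (lookup-+ᵛ (family p k) (sumOf L k) j))
        (Aligned-+ (lookup (Y k) j) (¬Conflict⇒Aligned _ (lookup (family p k) j) (λ c → ¬c (k , j , c))) (aligned k j))
    ... | no _  | inj₂ cl = inj₂ record
      { clashing = clashing ; others = p ∷ others ; clash = clash
      ; sumOf≡ = λ k → ≡.trans (≡.cong (family p k +ᵛ_) (sumOf≡ k)) (swap (family p k) (family clashing k) (sumOf others k))
      ; cost≡ = ≡.trans (≡.cong (∣∣ family p ∣∣ +ℕ_) cost≡) (+ℕ-swapˡ ∣∣ family p ∣∣ ∣∣ family clashing ∣∣ (cost others)) }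
      where
      open Clashing cl
      swap : ∀ (u v w : ℤ^ n) → u +ᵛ (v +ᵛ w) ≡ v +ᵛ (u +ᵛ w)
      swap u v w = ≡.trans (≡.sym (+ᵛ-assoc u v w)) (≡.trans (≡.cong (_+ᵛ w) (+ᵛ-comm u v)) (+ᵛ-assoc v u w))

    -- A part p of a decomposition of Z that is not coordinatewise below Z clashes with another
    -- part q.  Replacing p and q by the parts that p + q reduces to makes the decomposition smaller.
    descend : ∀ {b} → b ≢ 0ᵛ → Fin N → ∀ Z → Z Over b → (D : Decomposition Z) → Acc _<_ (size D) →
              ∃[ p ] (∀ k → family p k ⊑ Z k)
    -- Without parts `Z k₀` is a kernel vector, which would force b = 0.
    descend b≢0 k₀ Z over-b (decomposition [] R ker sums) _ = contradiction
      (≡.trans (≡.sym (over-b k₀)) (≡.trans (≡.cong (A *ᵛ_) (≡.trans (≡.sym (sums k₀)) (+ᵛ-identityˡ _))) (ker k₀))) b≢0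
    -- R lies over 0, so adding it to p leaves the vector of p unchanged, and the sum of L is then
    -- exactly what separates `Y k` from `Z k`.
    descend {b} b≢0 k₀ Z over-b D@(decomposition (p ∷ L) R ker sums) (acc rec) with findClash (family p +ᶠ R) L
    ... | inj₁ aligned = p′ , λ k → ≼ᵛ⇒⊑ {u = Y k} {Z k} λ j →
      ≡.subst (lookup (Y k) j ≼_) (≡.trans (≡.sym (lookup-+ᵛ (Y k) (sumOf L k) j)) (≡.cong (λ u → lookup u j) (Y+L≡Z k)))
        (Aligned⇒≼ (lookup (Y k) j) _ (aligned k j))
      where
      Y = family p +ᶠ R
      p′ : Part
      p′ = part (vector∈ p) Y λ k → ≡.trans (*ᵛ-+ᵛ A (family p k) (R k))
             (≡.trans (≡.cong₂ _+ᵛ_ (over p k) (ker k)) (+ᵛ-identityʳ _))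
      Y+L≡Z : ∀ k → Y k +ᵛ sumOf L k ≡ Z k
      Y+L≡Z k = ≡.trans (≡.trans (+ᵛ-assoc _ _ _) (≡.trans (≡.cong (family p k +ᵛ_) (+ᵛ-comm _ _)) (≡.sym (+ᵛ-assoc _ _ _)))) (sums k)
    ... | inj₂ cl with decompose (reduces (vector∈ p) (vector∈ (Clashing.clashing cl))) ((family p +ᶠ R) +ᶠ family (Clashing.clashing cl)) over-sum
      where
      open Clashing cl
      over-sum : ((family p +ᶠ R) +ᶠ family clashing) Over (vector p +ᵛ vector clashing)
      over-sum k = ≡.trans (*ᵛ-+ᵛ A (family p k +ᵛ R k) (family clashing k)) (≡.cong₂ _+ᵛ_
        (≡.trans (*ᵛ-+ᵛ A (family p k) (R k)) (≡.trans (≡.cong₂ _+ᵛ_ (over p k) (ker k)) (+ᵛ-identityʳ _))) (over clashing k))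
    ...   | E , size≤ = descend b≢0 k₀ Z over-b D′ (rec smaller)
      where
      open Clashing cl
      q = family clashing
      sums′ : ∀ k → sumOf (parts E ++ others) k +ᵛ remainder E k ≡ Z k
      sums′ k = begin
        sumOf (parts E ++ others) k +ᵛ remainder E k               ≡⟨ ≡.cong (_+ᵛ remainder E k) (sumOf-++ (parts E) others k) ⟩
        (sumOf (parts E) k +ᵛ sumOf others k) +ᵛ remainder E k    ≡⟨ exchange _ _ _ ⟩
        (sumOf (parts E) k +ᵛ remainder E k) +ᵛ sumOf others k    ≡⟨ ≡.cong (_+ᵛ sumOf others k) (Decomposition.sums E k) ⟩
        ((family p k +ᵛ R k) +ᵛ q k) +ᵛ sumOf others k             ≡⟨ +ᵛ-assoc _ _ _ ⟩
        (family p k +ᵛ R k) +ᵛ (q k +ᵛ sumOf others k)             ≡⟨ ≡.cong ((family p k +ᵛ R k) +ᵛ_) (sumOf≡ k) ⟨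
        (family p k +ᵛ R k) +ᵛ sumOf L k                           ≡⟨ exchange _ _ _ ⟩
        (family p k +ᵛ sumOf L k) +ᵛ R k                           ≡⟨ sums k ⟩
        Z k                                                         ∎
        where
        open ≡-Reasoning
        exchange : ∀ (u v w : ℤ^ n) → (u +ᵛ v) +ᵛ w ≡ (u +ᵛ w) +ᵛ v
        exchange u v w = ≡.trans (+ᵛ-assoc u v w) (≡.trans (≡.cong (u +ᵛ_) (+ᵛ-comm v w)) (≡.sym (+ᵛ-assoc u w v)))
      D′ : Decomposition Z
      -- R has entered the sum that was reduced, so the remainder of E is the only one left.
      D′ = decomposition (parts E ++ others) (remainder E) (kernel E) sums′
      smaller : size D′ < size D
      smaller = begin-strict
        cost (parts E ++ others) +ℕ ∣∣ remainder E ∣∣               ≡⟨ ≡.cong (_+ℕ ∣∣ remainder E ∣∣) (cost-++ (parts E) others) ⟩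
        (cost (parts E) +ℕ cost others) +ℕ ∣∣ remainder E ∣∣        ≡⟨ +ℕ-swapʳ (cost (parts E)) _ _ ⟩
        size E +ℕ cost others                                       ≤⟨ ℕP.+-monoˡ-≤ (cost others) size≤ ⟩
        ∣∣ (family p +ᶠ R) +ᶠ q ∣∣ +ℕ cost others                    <⟨ ℕP.+-monoˡ-< (cost others) (Clash⇒∣∣+ᶠ∣∣< (family p +ᶠ R) q clash) ⟩
        (∣∣ family p +ᶠ R ∣∣ +ℕ ∣∣ q ∣∣) +ℕ cost others              ≤⟨ ℕP.+-monoˡ-≤ (cost others) (ℕP.+-monoˡ-≤ ∣∣ q ∣∣ (∣∣+ᶠ∣∣ (family p) R)) ⟩
        ((∣∣ family p ∣∣ +ℕ ∣∣ R ∣∣) +ℕ ∣∣ q ∣∣) +ℕ cost others       ≡⟨ ℕP.+-assoc (∣∣ family p ∣∣ +ℕ ∣∣ R ∣∣) _ _ ⟩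
        (∣∣ family p ∣∣ +ℕ ∣∣ R ∣∣) +ℕ (∣∣ q ∣∣ +ℕ cost others)       ≡⟨ ≡.cong ((∣∣ family p ∣∣ +ℕ ∣∣ R ∣∣) +ℕ_) cost≡ ⟨
        (∣∣ family p ∣∣ +ℕ ∣∣ R ∣∣) +ℕ cost L                       ≡⟨ +ℕ-swapʳ ∣∣ family p ∣∣ _ _ ⟩
        (∣∣ family p ∣∣ +ℕ cost L) +ℕ ∣∣ R ∣∣                       ∎
        where
        open ℕP.≤-Reasoning

    -- Writes z as a sum of vectors ±eᵢ, the same for every index k. Those mapped to 0 by A have no
    -- counterpart in G and go into r.
    constant : ∀ z → ∃[ L ] ∃[ r ] (A *ᵛ r ≡ 0ᵛ × (∀ k → sumOf L k +ᵛ r ≡ z))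
    constant = ℤ^-induction n _ ([] , 0ᵛ , *ᵛ-0ᵛ A , λ _ → +ᵛ-identityˡ 0ᵛ)
      (λ { u v (L , r , r∈ , eq) (M , s , s∈ , eq′) → L ++ M , r +ᵛ s ,
           ≡.trans (*ᵛ-+ᵛ A r s) (≡.trans (≡.cong₂ _+ᵛ_ r∈ s∈) (+ᵛ-identityˡ 0ᵛ)) ,
           λ k → ≡.trans (≡.cong (_+ᵛ (r +ᵛ s)) (sumOf-++ L M k))
                   (≡.trans (interchange (sumOf L k) (sumOf M k) r s) (≡.cong₂ _+ᵛ_ (eq k) (eq′ k))) })
      (λ i → single (unit i) (gens⊆ ∘ column∈generators i))
      (λ i → single (-ᵛ unit i) (gens⊆ ∘ -column∈generators i))
      where
      interchange : ∀ (u v w x : ℤ^ n) → (u +ᵛ v) +ᵛ (w +ᵛ x) ≡ (u +ᵛ w) +ᵛ (v +ᵛ x)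
      interchange u v w x = begin
        (u +ᵛ v) +ᵛ (w +ᵛ x)   ≡⟨ +ᵛ-assoc u v (w +ᵛ x) ⟩
        u +ᵛ (v +ᵛ (w +ᵛ x))   ≡⟨ ≡.cong (u +ᵛ_) (≡.trans (≡.sym (+ᵛ-assoc v w x)) (≡.trans (≡.cong (_+ᵛ x) (+ᵛ-comm v w)) (+ᵛ-assoc w v x))) ⟩
        u +ᵛ (w +ᵛ (v +ᵛ x))   ≡⟨ +ᵛ-assoc u w (v +ᵛ x) ⟨
        (u +ᵛ w) +ᵛ (v +ᵛ x)   ∎
        where open ≡-Reasoning
      single : ∀ z → (A *ᵛ z ≢ 0ᵛ → A *ᵛ z ∈ G) → ∃[ L ] ∃[ r ] (A *ᵛ r ≡ 0ᵛ × (∀ k → sumOf L k +ᵛ r ≡ z))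
      single z ∈G with A *ᵛ z ≟ᵛ 0ᵛ
      ... | yes Az≡0 = [] , z , Az≡0 , λ _ → +ᵛ-identityˡ z
      ... | no Az≢0  = part (∈G Az≢0) (λ _ → z) (λ _ → ≡.refl) ∷ [] , 0ᵛ , *ᵛ-0ᵛ A ,
                       λ _ → ≡.trans (+ᵛ-identityʳ _) (+ᵛ-identityʳ z)

    -- Decomposing the single point `Z k₀` is enough: the other members differ from it by kernel
    -- vectors, which the remainder absorbs.
    initial : ∀ {b} → Fin N → ∀ Z → Z Over b → Decomposition Z
    initial {b} k₀ Z over-b with constant (Z k₀)
    ... | L , r , r∈ , eq = decomposition L (λ k → r +ᵛ (Z k -ᵛ Z k₀))
      (λ k → ≡.trans (*ᵛ-+ᵛ A r _) (≡.trans (≡.cong₂ _+ᵛ_ r∈ (≡.trans (*ᵛ-minus A (Z k) (Z k₀))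
        (≡.trans (≡.cong₂ _-ᵛ_ (over-b k) (over-b k₀)) (u-u≡0 b)))) (+ᵛ-identityˡ 0ᵛ)))
      (λ k → ≡.trans (≡.sym (+ᵛ-assoc _ r _)) (≡.trans (≡.cong (_+ᵛ (Z k -ᵛ Z k₀)) (eq k)) (u+[v-u]≡v (Z k₀) (Z k))))

  -- Atomic fibers in the output

  covered : ∀ {G} → generators A ⊆ˡ G → (∀ {f g} → f ∈ G → g ∈ G → ReducesToZero G (f +ᵛ g)) →
            ∀ {b} → b ≢ 0ᵛ → Image b → ∃[ g ] (g ∈ G × Covers A g b)
  covered {G} gens⊆ reduces {b} b≢0 (z₀ , z₀∈) = vector p , vector∈ p , λ z z∈ →
      -- Every z of the fiber dominates some basis point `Z k`, and the family of p lies below all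
      -- of these.
      let any = below z z∈ ; k = Any.index any in
      family p k , over p k , ⊑-trans {u = family p k} {Z k} {z} (p⊑Z k) (AnyP.lookup-index any)
    where
    open Basis (basis A b)
    open Descent gens⊆ reduces (length elements)
    open Part
    Z : Family
    Z = List.lookup elements
    over-b : Z Over b
    over-b k = All.lookup inFiber (∈-lookup k)
    k₀ = Any.index (below z₀ z₀∈)
    result = descend b≢0 k₀ Z over-b (initial k₀ Z over-b) (<-wellFounded _)
    p = proj₁ result
    p⊑Z = proj₂ result

  atomic⇒Image : ∀ {b} → b ≢ 0ᵛ → Atomic A b → Image b
  atomic⇒Image {b} b≢0 atomic with Basis.elements (basis A b) | Basis.inFiber (basis A b) | Basis.below (basis A b)
  ... | z ∷ _ | z∈ ∷ _ | _     = z , z∈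
  ... | []    | _      | below = contradiction
    -- An empty fiber decomposes vacuously; b₁ = b₂ = 0 are admissible because b ≠ 0.
    (0ᵛ , 0ᵛ , b≢0 ∘ ≡.sym , b≢0 ∘ ≡.sym , λ z z∈ → contradiction (below z z∈) λ ()) atomic

  atomic∈ : ∀ {G} → Closed G (λ _ → ⊥) → ∀ {b} → Atomic A b → b ∈ 0ᵛ ∷ G
  atomic∈ {G} closed {b} atomic with b ≟ᵛ 0ᵛ
  ... | yes b≡0 = here b≡0
  ... | no b≢0 with covered generators⊆ (λ f∈ g∈ → [ (λ ()) , id ] (sums f∈ g∈))
                            b≢0 (atomic⇒Image b≢0 atomic)
    where open Closed closed
  ...   | g , g∈ , cov with g ≟ᵛ b
  ...     | yes ≡.refl = there g∈
  -- Since g ≠ 0, b - g also differs from b, so this would be a decomposition that atomicity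
  -- forbids.
  ...     | no g≢b = contradiction (g , b -ᵛ g , g≢b , b-g≢b , Covers⇒ReducibleBy A cov) atomic
    where
    b-g≢b : b -ᵛ g ≢ b
    b-g≢b eq = Closed.nonzero closed g∈ (begin
      g                       ≡⟨ [u+v]-u≡v b g ⟨
      (b +ᵛ g) -ᵛ b           ≡⟨ ≡.cong (_-ᵛ b) (≡.trans (≡.cong (_+ᵛ g) (≡.sym eq)) (≡.trans (+ᵛ-comm _ g) (u+[v-u]≡v g b))) ⟩
      b -ᵛ b                  ≡⟨ u-u≡0 b ⟩
      0ᵛ                      ∎)
      where open ≡-Reasoning

lemma4p3 : (d n : ℕ) (A : Matrix d n) →
    Acc (flip (Step A)) (start A)
    × (∀ c → Star (Step A) (start A) c →
    (∃[ c′ ] Step A c c′) ⊎ (∃[ G ] c ≡ returned G))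
    × (∀ G → Star (Step A) (start A) (returned G) →
    ∀ b → Atomic A b → ∃[ g ] (g ∈ G × Fiber A g ≐ Fiber A b))
lemma4p3 d n A = start-terminates A , (λ c _ → progress A c) , λ G run b atomic →
  let _ , G≡ , closed = invariant A run (invariant-start A) in
  b , ≡.subst (b ∈_) (≡.sym G≡) (atomic∈ A closed atomic) , id , id
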